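{- Let $G,H\in\mathbb{GS}$. If $G\sim H$ and both $G$ and $H$ are reduced, then $G$ and $H$ are identical (they have the same game tree with the same atoms in the same positions).
   Context: A scoring game is written $G=\langle G^{\mathcal L}\mid G^{\mathcal R}\rangle$, where each of $G^{\mathcal L}$ (Left options) and $G^{\mathcal R}$ (Right options) is either a finite nonempty set of scoring games or an atom $\emptyset^{s}$, $s\in\mathbb R$ (the player to move on that side cannot move and the game ends with score $s$); game trees are finite. An atom occurring in $G$ is an atom of $G$ or of any follower of $G$. $G$ is guaranteed if for every follower $K$ of $G$: if $K^{\mathcal L}=\emptyset^\ell$ then $\ell\le s$ for every atom $\emptyset^s$ occurring in $K$, and if $K^{\mathcal R}=\emptyset^r$ then $s\le r$ for every atom $\emptyset^s$ occurring in $K$; $\mathbb{GS}$ is the class of guaranteed games. Disjunctive sum $G+H$: Left options are $G^L+H$ and $G+H^L$, except if both are left-atomic with atoms $\emptyset^{\ell_1},\emptyset^{\ell_2}$, then $(G+H)^{\mathcal L}=\emptyset^{\ell_1+\ell_2}$; Right symmetric. Stops: $Ls(G)=\ell$ if $G^{\mathcal L}=\emptyset^\ell$, otherwise $\max_{G^L}Rs(G^L)$; $Rs(G)=r$ if $G^{\mathcal R}=\emptyset^r$, otherwise $\min_{G^R}Ls(G^R)$. $G\succcurlyeq H$ iff $Ls(G+X)\ge Ls(H+X)$ and $Rs(G+X)\ge Rs(H+X)$ for all $X\in\mathbb{GS}$; $G\sim H$ iff both $G\succcurlyeq H$ and $H\succcurlyeq G$. Conjugate $\overleftrightarrow{G}=\langle\overleftrightarrow{G^{\mathcal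 R}}\mid\overleftrightarrow{G^{\mathcal L}}\rangle$ (atom $\emptyset^s$ becomes $\emptyset^{ -s}$); waiting moves $\widehat 0=\langle\emptyset^0\mid\emptyset^0\rangle$, $\widehat{k+1}=\langle\widehat k\mid\emptyset^0\rangle$, $-\widehat k=\overleftrightarrow{\widehat k}$; a real $x$ denotes $\langle\emptyset^x\mid\emptyset^x\rangle$. $\underline{Ls}(G)=\min_{k\ge0}Ls(G-\widehat k)$, $\underline{Rs}(G)=\min_{k\ge0}Rs(G-\widehat k)$. A Left option $A$ of $G$ is reversible through $B$ if $B$ is a Right option of $A$ with $G\succcurlyeq B$; it is atomic-reversible if moreover $B=\langle\emptyset^\ell\mid B^{\mathcal R}\rangle$ is left-atomic. The Left reductions are: (i) if $A,B\in G^{\mathcal L}$ are distinct with $B\succcurlyeq A$, delete $A$; (ii) if $A\in G^{\mathcal L}$ is reversible through $B$ with $B^{\mathcal L}$ a nonempty set, replace $A$ by the options in $B^{\mathcal L}$; (iii) if $A$ is atomic-reversible through $B=\langle\emptyset^\ell\mid B^{\mathcal R}\rangle$: if $\underline{Ls}(G)=\underline{Rs}(G^L)$ for some other $G^L\in G^{\mathcal L}$, delete $A$; if instead $\underline{Ls}(G)=\underline{Rs}(A)>\underline{Rs}(G^L)$ for all other $G^L$, replace $A$ by $\ell-\widehat{n+1}$ where $n$ is the least nonnegative integer with $G\succcurlyeq\ell-\widehat n$; (iv) in the latter situation, if $A$ is the only Left option and $\langle\emptyset^\ell\mid G^{\mathcal R}\rangle\in\mathbb{GS}$, replace $G$ by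 $\langle\emptyset^\ell\mid G^{\mathcal R}\rangle$. Right reductions are the symmetric ones (Left and Right interchanged). Each reduction yields a game equivalent to $G$. $G$ is reduced if no reduction can be applied to $G$, or to any follower of $G$, so as to obtain an equivalent game with different sets of options. -}

module Defs where

open import Data.Nat as ℕ using (ℕ; zero; suc)
open import Data.Empty using (⊥)
open import Data.Product using (Σ; ∃; _×_; _,_; ∃-syntax)
open import Data.Sum using (_⊎_)
open import Data.List using (List; []; _∷_)
open import Data.List.NonEmpty using (List⁺; _∷_; toList; [_])
open import Data.List.Membership.Propositional using (_∈_)
open import Relation.Binary.PropositionalEquality using (_≡_)
open import Relation.Nullary using (¬_; Dec; yes; no)
open import Algebra.Structures using (IsCommutativeRing)

-- The real numbers, axiomatised as a Dedekind-complete ordered field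
-- (unique up to isomorphism, so quantifying over all models is the same
-- as speaking about ℝ).  The order is assumed decidable, which holds
-- classically for ℝ and is needed to compute max/min in the stops.

record RealField : Set₁ where
  infixl 6 _+_
  infixl 7 _*_
  infix 4 _≤_
  field
    ℝ : Set
    _+_ _*_ : ℝ → ℝ → ℝ
    -_ : ℝ → ℝ
    0# 1# : ℝ
    _≤_ : ℝ → ℝ → Set
    isCommutativeRing : IsCommutativeRing _≡_ _+_ _*_ -_ 0# 1#
    0≢1 : ¬ (0# ≡ 1#)
    inverse : ∀ x → ¬ (x ≡ 0#) → ∃[ y ] (x * y ≡ 1#)
    ≤-refl : ∀ {x} → x ≤ x
    ≤-trans : ∀ {x y z} → x ≤ y → y ≤ z → x ≤ z
    ≤-antisym : ∀ {x y} → x ≤ y → y ≤ x → x ≡ y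
    ≤-total : ∀ x y → x ≤ y ⊎ y ≤ x
    _≤?_ : ∀ x y → Dec (x ≤ y)
    +-monoˡ-≤ : ∀ {x y} z → x ≤ y → x + z ≤ y + z
    *-nonneg : ∀ {x y} → 0# ≤ x → 0# ≤ y → 0# ≤ x * y
    complete : (P : ℝ → Set) → (∃[ x ] P x) → (∃[ u ] (∀ x → P x → x ≤ u)) →
               ∃[ s ] ((∀ x → P x → x ≤ s) × (∀ u → (∀ x → P x → x ≤ u) → s ≤ u))

module Games (RF : RealField) where
  open RealField RF

  _<_ : ℝ → ℝ → Set
  x < y = x ≤ y × ¬ (y ≤ x)

  max min : ℝ → ℝ → ℝ
  max x y with x ≤? y
  ... | yes _ = y
  ... | no _ = x
  min x y with x ≤? y
  ... | yes _ = x
  ... | no _ = y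

  -- A side of a game is either an atom ∅^s or a finite nonempty set of
  -- options (represented by a nonempty list; lists are compared as sets,
  -- see Ident below).
  mutual
    data Game : Set where
      ⟨_∣_⟩ : Side → Side → Game

    data Side : Set where
      atom : ℝ → Side
      opts : List⁺ Game → Side

  Lside Rside : Game → Side
  Lside ⟨ l ∣ _ ⟩ = l
  Rside ⟨ _ ∣ r ⟩ = r

  _∈S_ : Game → Side → Set
  x ∈S atom _ = ⊥
  x ∈S opts xs = x ∈ toList xs

  _∈L_ _∈R_ : Game → Game → Set
  A ∈L G = A ∈S Lside G
  A ∈R G = A ∈S Rside G

  mutual
    data Ident : Game → Game → Set where
      ⟨_∣_⟩ : ∀ {l r l′ r′} → IdentS l l′ → IdentS r r′ → Ident ⟨ l ∣ r ⟩ ⟨ l′ ∣ r′ ⟩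

    data IdentS : Side → Side → Set where
      atom : ∀ {s} → IdentS (atom s) (atom s)
      opts : ∀ {xs ys} →
             (∀ x → x ∈ toList xs → ∃[ y ] (y ∈ toList ys × Ident x y)) →
             (∀ y → y ∈ toList ys → ∃[ x ] (x ∈ toList xs × Ident x y)) →
             IdentS (opts xs) (opts ys)

  data Follower : Game → Game → Set where
    here : ∀ {G} → Follower G G
    viaL : ∀ {K A G} → A ∈L G → Follower K A → Follower K G
    viaR : ∀ {K A G} → A ∈R G → Follower K A → Follower K G

  AtomOf : ℝ → Game → Set
  AtomOf s K = Lside K ≡ atom s ⊎ Rside K ≡ atom s

  Occurs : ℝ → Game → Set
  Occurs s G = ∃[ K ] (Follower K G × AtomOf s K)

  Guaranteed : Game → Set
  Guaranteed G = ∀ K → Follower K G →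
    (∀ ℓ → Lside K ≡ atom ℓ → ∀ s → Occurs s K → ℓ ≤ s) ×
    (∀ r → Rside K ≡ atom r → ∀ s → Occurs s K → s ≤ r)

  mutual
    Ls : Game → ℝ
    Ls ⟨ atom ℓ ∣ _ ⟩ = ℓ
    Ls ⟨ opts (A ∷ As) ∣ _ ⟩ = maxRs A As

    Rs : Game → ℝ
    Rs ⟨ _ ∣ atom r ⟩ = r
    Rs ⟨ _ ∣ opts (A ∷ As) ⟩ = minLs A As

    maxRs : Game → List Game → ℝ
    maxRs A [] = Rs A
    maxRs A (B ∷ Bs) = max (Rs A) (maxRs B Bs)

    minLs : Game → List Game → ℝ
    minLs A [] = Ls A
    minLs A (B ∷ Bs) = min (Ls A) (minLs B Bs)

  infixl 6 _⊕_ _⊖_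
  mutual
    _⊕_ : Game → Game → Game
    G@(⟨ gl ∣ gr ⟩) ⊕ H@(⟨ hl ∣ hr ⟩) = ⟨ sumL gl hl G H ∣ sumR gr hr G H ⟩

    sumL : Side → Side → Game → Game → Side
    sumL (atom a) (atom b) G H = atom (a + b)
    sumL (atom a) (opts hs) G H = opts (addL G hs)
    sumL (opts gs) (atom b) G H = opts (addR gs H)
    sumL (opts gs) (opts hs) G H = opts (addR gs H Data.List.NonEmpty.⁺++⁺ addL G hs)

    sumR : Side → Side → Game → Game → Side
    sumR (atom a) (atom b) G H = atom (a + b)
    sumR (atom a) (opts hs) G H = opts (addL G hs)
    sumR (opts gs) (atom b) G H = opts (addR gs H)
    sumR (opts gs) (opts hs) G H = opts (addR gs H Data.List.NonEmpty.⁺++⁺ addL G hs)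

    addL : Game → List⁺ Game → List⁺ Game
    addL G (h ∷ hs) = (G ⊕ h) ∷ addL′ G hs

    addL′ : Game → List Game → List Game
    addL′ G [] = []
    addL′ G (h ∷ hs) = (G ⊕ h) ∷ addL′ G hs

    addR : List⁺ Game → Game → List⁺ Game
    addR (g ∷ gs) H = (g ⊕ H) ∷ addR′ gs H

    addR′ : List Game → Game → List Game
    addR′ [] H = []
    addR′ (g ∷ gs) H = (g ⊕ H) ∷ addR′ gs H

  mutual
    conj : Game → Game
    conj ⟨ l ∣ r ⟩ = ⟨ conjS r ∣ conjS l ⟩

    conjS : Side → Side
    conjS (atom s) = atom (- s)
    conjS (opts (x ∷ xs)) = opts (conj x ∷ conjL xs)

    conjL : List Game → List Game
    conjL [] = []
    conjL (x ∷ xs) = conj x ∷ conjL xs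

  _⊖_ : Game → Game → Game
  G ⊖ H = G ⊕ conj H

  real : ℝ → Game
  real x = ⟨ atom x ∣ atom x ⟩

  ŵ : ℕ → Game
  ŵ zero = ⟨ atom 0# ∣ atom 0# ⟩
  ŵ (suc k) = ⟨ opts [ ŵ k ] ∣ atom 0# ⟩

  infix 4 _≽_ _∼_
  _≽_ : Game → Game → Set
  G ≽ H = ∀ X → Guaranteed X → (Ls (H ⊕ X) ≤ Ls (G ⊕ X)) × (Rs (H ⊕ X) ≤ Rs (G ⊕ X))

  _∼_ : Game → Game → Set
  G ∼ H = G ≽ H × H ≽ G

  -- v is the minimum/maximum over k ≥ 0 (as a relation: "equals")
  -- underline Ls(G) = min_k Ls(G - ŵ k),  underline Rs(G) = min_k Rs(G - ŵ k)
  ULs URs : Game → ℝ → Set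
  ULs G v = (∃[ k ] Ls (G ⊖ ŵ k) ≡ v) × (∀ k → v ≤ Ls (G ⊖ ŵ k))
  URs G v = (∃[ k ] Rs (G ⊖ ŵ k) ≡ v) × (∀ k → v ≤ Rs (G ⊖ ŵ k))
  OLs ORs : Game → ℝ → Set
  OLs G v = (∃[ k ] Ls (G ⊕ ŵ k) ≡ v) × (∀ k → Ls (G ⊕ ŵ k) ≤ v)
  ORs G v = (∃[ k ] Rs (G ⊕ ŵ k) ≡ v) × (∀ k → Rs (G ⊕ ŵ k) ≤ v)

  SetIs : List⁺ Game → (Game → Set) → Set
  SetIs ys P = (∀ y → y ∈ toList ys → P y) × (∀ z → P z → ∃[ y ] (y ∈ toList ys × Ident y z))

  Others : List⁺ Game → Game → Game → Set
  Others xs A z = ∃[ x ] (x ∈ toList xs × ¬ Ident x A × Ident x z)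

  LeftIIIb : List⁺ Game → Side → Game → ℝ → ℕ → Set
  LeftIIIb xs gr A ℓ n =
    A ∈ toList xs ×
    (∃[ B ] (B ∈R A × ⟨ opts xs ∣ gr ⟩ ≽ B × Lside B ≡ atom ℓ)) ×
    (∃[ v ] (ULs ⟨ opts xs ∣ gr ⟩ v × URs A v ×
       (∀ C → C ∈ toList xs → ¬ Ident C A → ∀ w → URs C w → w < v))) ×
    (⟨ opts xs ∣ gr ⟩ ≽ real ℓ ⊖ ŵ n) ×
    (∀ m → m ℕ.< n → ¬ (⟨ opts xs ∣ gr ⟩ ≽ real ℓ ⊖ ŵ m))

  data LRed : Game → Game → Set where
    red-i : ∀ {xs gr ys A B} → A ∈ toList xs → B ∈ toList xs → ¬ Ident A B →
      B ≽ A → SetIs ys (Others xs A) →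
      LRed ⟨ opts xs ∣ gr ⟩ ⟨ opts ys ∣ gr ⟩
    red-ii : ∀ {xs gr ys A B bs} → A ∈ toList xs → B ∈R A →
      ⟨ opts xs ∣ gr ⟩ ≽ B → Lside B ≡ opts bs →
      SetIs ys (λ z → Others xs A z ⊎ ∃[ b ] (b ∈ toList bs × Ident b z)) →
      LRed ⟨ opts xs ∣ gr ⟩ ⟨ opts ys ∣ gr ⟩
    red-iii-a : ∀ {xs gr ys A B ℓ} → A ∈ toList xs → B ∈R A →
      ⟨ opts xs ∣ gr ⟩ ≽ B → Lside B ≡ atom ℓ →
      (∃[ C ] (C ∈ toList xs × ¬ Ident C A ×
         ∃[ v ] (ULs ⟨ opts xs ∣ gr ⟩ v × URs C v))) →
      SetIs ys (Others xs A) →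
      LRed ⟨ opts xs ∣ gr ⟩ ⟨ opts ys ∣ gr ⟩
    red-iii-b : ∀ {xs gr ys A ℓ n} → LeftIIIb xs gr A ℓ n →
      SetIs ys (λ z → Others xs A z ⊎ Ident (real ℓ ⊖ ŵ (suc n)) z) →
      LRed ⟨ opts xs ∣ gr ⟩ ⟨ opts ys ∣ gr ⟩
    red-iv : ∀ {xs gr A ℓ n} → LeftIIIb xs gr A ℓ n →
      (∀ x → x ∈ toList xs → Ident x A) →
      Guaranteed ⟨ atom ℓ ∣ gr ⟩ →
      LRed ⟨ opts xs ∣ gr ⟩ ⟨ atom ℓ ∣ gr ⟩

  RightIIIb : Side → List⁺ Game → Game → ℝ → ℕ → Set
  RightIIIb gl xs A r n =
    A ∈ toList xs ×
    (∃[ B ] (B ∈L A × B ≽ ⟨ gl ∣ opts xs ⟩ × Rside B ≡ atom r)) ×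
    (∃[ v ] (ORs ⟨ gl ∣ opts xs ⟩ v × OLs A v ×
       (∀ C → C ∈ toList xs → ¬ Ident C A → ∀ w → OLs C w → v < w))) ×
    (real r ⊕ ŵ n ≽ ⟨ gl ∣ opts xs ⟩) ×
    (∀ m → m ℕ.< n → ¬ (real r ⊕ ŵ m ≽ ⟨ gl ∣ opts xs ⟩))

  data RRed : Game → Game → Set where
    red-i : ∀ {gl xs ys A B} → A ∈ toList xs → B ∈ toList xs → ¬ Ident A B →
      A ≽ B → SetIs ys (Others xs A) →
      RRed ⟨ gl ∣ opts xs ⟩ ⟨ gl ∣ opts ys ⟩
    red-ii : ∀ {gl xs ys A B bs} → A ∈ toList xs → B ∈L A →
      B ≽ ⟨ gl ∣ opts xs ⟩ → Rside B ≡ opts bs →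
      SetIs ys (λ z → Others xs A z ⊎ ∃[ b ] (b ∈ toList bs × Ident b z)) →
      RRed ⟨ gl ∣ opts xs ⟩ ⟨ gl ∣ opts ys ⟩
    red-iii-a : ∀ {gl xs ys A B r} → A ∈ toList xs → B ∈L A →
      B ≽ ⟨ gl ∣ opts xs ⟩ → Rside B ≡ atom r →
      (∃[ C ] (C ∈ toList xs × ¬ Ident C A ×
         ∃[ v ] (ORs ⟨ gl ∣ opts xs ⟩ v × OLs C v))) →
      SetIs ys (Others xs A) →
      RRed ⟨ gl ∣ opts xs ⟩ ⟨ gl ∣ opts ys ⟩
    red-iii-b : ∀ {gl xs ys A r n} → RightIIIb gl xs A r n →
      SetIs ys (λ z → Others xs A z ⊎ Ident (real r ⊕ ŵ (suc n)) z) →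
      RRed ⟨ gl ∣ opts xs ⟩ ⟨ gl ∣ opts ys ⟩
    red-iv : ∀ {gl xs A r n} → RightIIIb gl xs A r n →
      (∀ x → x ∈ toList xs → Ident x A) →
      Guaranteed ⟨ gl ∣ atom r ⟩ →
      RRed ⟨ gl ∣ opts xs ⟩ ⟨ gl ∣ atom r ⟩

  Reduction : Game → Game → Set
  Reduction K K′ = LRed K K′ ⊎ RRed K K′

  Reduced : Game → Set
  Reduced G = ∀ K → Follower K G → ∀ K′ → Reduction K K′ → Ident K K′

{-# OPTIONS --safe #-}

-- Comparison of guaranteed games is local, hence decidable: G ≽ H holds iff every Left move A
-- of H is matched by a Left option C ≽ A of G or has a Right reply B with G ≽ B, a Left atom
-- of H is at most the pass-allowed Left stop of G, and the Right analogues hold; when this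
-- fails, a game X separating G from H is assembled from separating games for the options.
-- Let G ∼ H be reduced. A non-reversible option of H is dominated by an option of G, which
-- is again non-reversible and hence dominated by an option of H; no domination in H makes the
-- two equivalent, so identical by induction. A reversible option of a reduced game is
-- atomic-reversible and is the unique option attaining the pass-allowed stop, of the form
-- ℓ - n+1 waiting moves; ℓ is that stop and n is least with G ≽ ℓ - n̂, so ℓ and n depend only
-- on the equivalence class. The remaining case, an atom of G against such an option of H, is
-- excluded because reduction (iv) would apply to H.

module Submission where

open import Defs
open import Data.Nat as ℕ using (ℕ; zero; suc)
import Data.Nat.Properties as ℕₚ
open import Data.Empty using (⊥-elim)
open import Data.Product using (_×_; _,_; ∃-syntax; proj₁; proj₂)
open import Data.Sum using (_⊎_; inj₁; inj₂; [_,_]′; swap)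
open import Data.List using (List; []; _∷_; _++_; filter)
open import Data.List.NonEmpty as List⁺ using (List⁺; _∷_; toList)
open import Data.List.Membership.Propositional using (_∈_)
open import Data.List.Membership.Propositional.Properties using (∈-++⁺ˡ; ∈-++⁺ʳ; ∈-++⁻; ∈-filter⁺; ∈-filter⁻)
open import Data.List.Relation.Unary.Any using (here; there)
open import Relation.Binary.PropositionalEquality using (_≡_; refl; sym; trans; cong; cong₂; subst; subst₂)
open import Relation.Nullary using (¬_; Dec; yes; no)
open import Relation.Nullary.Decidable using (¬?; toSum)
open import Algebra.Structures using (IsCommutativeRing)
import Algebra.Properties.Ring as RingProperties

-- Sums give no shortcut to comparison: a game plus its conjugate need not be equivalent to 0, as
-- ⟨∅^0 | ∅^1⟩ shows, so `G ≽ H` cannot be tested by playing out a difference. A failure has to be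
-- exhibited by some X, and the requirement that X be guaranteed constrains its atoms. Pass-allowed
-- stops enter because X can supply the opponent with any number of waiting moves; they are minima
-- over infinitely many k, attained because the stops are monotone in k and settle at an index
-- computed from the tree. Nothing classical is assumed beyond the decidable order on scores: the
-- case distinctions on comparability, reversibility and the least n rest on `ge-dec`, which returns
-- either a comparison or an explicit separating game. The last case has its own obstacle: (iv)
-- demands that ⟨∅^ℓ | H^R⟩ be guaranteed, while H^R may itself differ from G^R in the same
-- exceptional way. Only atoms matter there, and even an exceptional side carries the same atoms in
-- both games, since all atoms of ℓ minus waiting moves equal ℓ.

module Uniqueness (RF : RealField) where
  open RealField RF
  open Games RF
  open IsCommutativeRing isCommutativeRing
    using (+-assoc; +-comm; +-identityʳ; -‿inverseˡ; -‿inverseʳ; isRing)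

  -- The two players and the order on scores as each sees it.

  data Player : Set where
    L R : Player

  -- A relation, so that one match fixes both players and `le`, `side` and `stop` then compute.
  -- Every lemma over `Opp p q` serves Left and Right at once.
  data Opp : Player → Player → Set where
    LR : Opp L R
    RL : Opp R L

  opp-sym : ∀ {p q} → Opp p q → Opp q p
  opp-sym LR = RL
  opp-sym RL = LR

  opp-cases : ∀ {p q} → Opp p q → ∀ r → r ≡ p ⊎ r ≡ q
  opp-cases LR L = inj₁ refl
  opp-cases LR R = inj₂ refl
  opp-cases RL L = inj₂ refl
  opp-cases RL R = inj₁ refl

  -- Read as: y suits p at least as well as x. Thus p picks `le p`-largest values and the opponent
  -- `le p`-smallest ones.
  le : Player → ℝ → ℝ → Set
  le L x y = x ≤ y
  le R x y = y ≤ x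

  le-refl : ∀ p {x} → le p x x
  le-refl L = ≤-refl
  le-refl R = ≤-refl

  le-reflexive : ∀ p {x y} → x ≡ y → le p x y
  le-reflexive p refl = le-refl p

  le-trans : ∀ p {x y z} → le p x y → le p y z → le p x z
  le-trans L a b = ≤-trans a b
  le-trans R a b = ≤-trans b a

  le-antisym : ∀ p {x y} → le p x y → le p y x → x ≡ y
  le-antisym L a b = ≤-antisym a b
  le-antisym R a b = ≤-antisym b a

  le-total : ∀ p x y → le p x y ⊎ le p y x
  le-total L x y = ≤-total x y
  le-total R x y = ≤-total y x

  le? : ∀ p x y → Dec (le p x y)
  le? L x y = x ≤? y
  le? R x y = y ≤? x

  le-flip : ∀ {p q x y} → Opp p q → le p x y → le q y x
  le-flip LR a = a
  le-flip RL a = a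

  ≰⇒le : ∀ p {x y} → ¬ le p x y → le p y x
  ≰⇒le p {x} {y} n with le-total p x y
  ... | inj₁ a = ⊥-elim (n a)
  ... | inj₂ a = a

  +-mono-≤ : ∀ {a b c d} → a ≤ b → c ≤ d → a + c ≤ b + d
  +-mono-≤ {a} {b} {c} {d} h k =
    ≤-trans (+-monoˡ-≤ c h) (subst₂ _≤_ (+-comm c b) (+-comm d b) (+-monoˡ-≤ b k))

  le-+ : ∀ p {a b c d} → le p a b → le p c d → le p (a + c) (b + d)
  le-+ L = +-mono-≤
  le-+ R = +-mono-≤

  +-cancel : ∀ a b → a + (- a + b) ≡ b
  +-cancel a b = trans (sym (+-assoc a (- a) b))
    (trans (cong (_+ b) (-‿inverseʳ a)) (trans (+-comm 0# b) (+-identityʳ b)))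

  -0≡0 : - 0# ≡ 0#
  -0≡0 = RingProperties.-0#≈0# (record { isRing = isRing })

  abstract
    meet : ∀ p x y → ∃[ z ] (le p z x × le p z y)
    meet p x y with le-total p x y
    ... | inj₁ a = x , le-refl p , a
    ... | inj₂ a = y , a , le-refl p

  positive : ∃[ e ] ¬ (e ≤ 0#)
  positive with ≤-total 0# 1#
  ... | inj₁ a = 1# , λ b → 0≢1 (≤-antisym a b)
  ... | inj₂ a = - 1# , λ b → 0≢1 (≤-antisym
    (subst₂ _≤_ (-‿inverseˡ 1#) (trans (+-comm 0# _) (+-identityʳ _)) (+-monoˡ-≤ 1# b)) a)

  abstract
    -- Supplies the atom with which p loses in a separating game: added to any score up to x, it
    -- stays strictly on the wrong side of 0.
    below : ∀ p x → ∃[ y ] (∀ g → le p g x → ¬ le p 0# (g + y))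
    below L x = let (e , e≰0) = positive in
      - x + - e , λ g g≤x h → e≰0
        (subst₂ _≤_ (trans (+-comm 0# e) (+-identityʳ e))
          (trans (cong (_+ e) (+-cancel x (- e))) (-‿inverseˡ e))
          (+-monoˡ-≤ e (≤-trans h (+-monoˡ-≤ _ g≤x))))
    below R x = let (e , e≰0) = positive in
      - x + e , λ g x≤g h → e≰0
        (≤-trans (subst (_≤ g + (- x + e)) (+-cancel x e) (+-monoˡ-≤ _ x≤g)) h)

  -- Games seen from one player, and induction over them.

  side : Player → Game → Side
  side L = Lside
  side R = Rside

  stop : Player → Game → ℝ
  stop L = Ls
  stop R = Rs

  infix 4 _∈[_]_
  _∈[_]_ : Game → Player → Game → Set
  A ∈[ p ] G = A ∈S side p G

  node : Player → Side → Side → Game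
  node L a b = ⟨ a ∣ b ⟩
  node R a b = ⟨ b ∣ a ⟩

  side-node : ∀ {p q} → Opp p q → ∀ a b → side p (node p a b) ≡ a
  side-node LR a b = refl
  side-node RL a b = refl

  side-node′ : ∀ {p q} → Opp p q → ∀ a b → side q (node p a b) ≡ b
  side-node′ LR a b = refl
  side-node′ RL a b = refl

  ∈-atom : ∀ {A S s} {X : Set} → S ≡ atom s → A ∈S S → X
  ∈-atom refl ()

  atom-injective : ∀ {s t} → Side.atom s ≡ atom t → s ≡ t
  atom-injective refl = refl

  module _ (P : Game → Set) (step : ∀ G → (∀ p A → A ∈[ p ] G → P A) → P G) where
    game-ind : ∀ G → P G
    side-ind : ∀ S A → A ∈S S → P A
    list-ind : ∀ xs A → A ∈ xs → P A
    game-ind ⟨ l ∣ r ⟩ = step ⟨ l ∣ r ⟩ λ { L A m → side-ind l A m ; R A m → side-ind r A m }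
    side-ind (opts (x ∷ xs)) A (here refl) = game-ind x
    side-ind (opts (x ∷ xs)) A (there m) = list-ind xs A m
    list-ind (x ∷ xs) A (here refl) = game-ind x
    list-ind (x ∷ xs) A (there m) = list-ind xs A m

  game-ind₂ : (P : Game → Game → Set) →
    (∀ G X → (∀ p A → A ∈[ p ] G → P A X) → (∀ p B → B ∈[ p ] X → P G B) → P G X) →
    ∀ G X → P G X
  game-ind₂ P step = game-ind (λ G → ∀ X → P G X) λ G ihG →
    game-ind (P G) λ X ihX → step G X (λ p A m → ihG p A m X) ihX

  via : ∀ p {K A G} → A ∈[ p ] G → Follower K A → Follower K G
  via L = viaL
  via R = viaR

  follower-trans : ∀ {J K G} → Follower J K → Follower K G → Follower J G
  follower-trans f here = f
  follower-trans f (viaL m g) = viaL m (follower-trans f g)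
  follower-trans f (viaR m g) = viaR m (follower-trans f g)

  follower-ind : (P : Game → Set) →
    (∀ G → (∀ p A → A ∈[ p ] G → ∀ K → Follower K A → P K) → P G) → ∀ G → P G
  follower-ind P step G = game-ind (λ G → ∀ K → Follower K G → P K)
    (λ { G ih K here → step K ih
       ; G ih K (viaL m f) → ih L _ m K f
       ; G ih K (viaR m f) → ih R _ m K f }) G G here

  -- Finite choice in place of excluded middle: the options are searched for a P, and if none turns
  -- up, Q holds throughout.
  ∈-dichotomy : ∀ S {P Q : Game → Set} → (∀ x → x ∈S S → P x ⊎ Q x) →
    (∃[ x ] (x ∈S S × P x)) ⊎ (∀ x → x ∈S S → Q x)
  ∈-dichotomy (atom _) d = inj₂ λ _ ()
  ∈-dichotomy (opts (y ∷ ys)) {P} {Q} d = go (y ∷ ys) d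
    where
    go : ∀ xs → (∀ x → x ∈ xs → P x ⊎ Q x) → (∃[ x ] (x ∈ xs × P x)) ⊎ (∀ x → x ∈ xs → Q x)
    go [] d = inj₂ λ _ ()
    go (x ∷ xs) d with d x (here refl) | go xs (λ z m → d z (there m))
    ... | inj₁ a | _ = inj₁ (x , here refl , a)
    ... | inj₂ _ | inj₁ (z , m , a) = inj₁ (z , there m , a)
    ... | inj₂ b | inj₂ c = inj₂ λ { z (here refl) → b ; z (there m) → c z m }

  -- Merges witnesses found option by option into a single one; `join` weakens two of them to a
  -- common third, and `t₀` serves the empty list.
  ∈-bound : ∀ S {T : Set} (P : Game → T → Set) → T →
    (∀ a b → ∃[ c ] ((∀ x → P x a → P x c) × (∀ x → P x b → P x c))) →
    (∀ x → x ∈S S → ∃[ t ] P x t) → ∃[ t ] (∀ x → x ∈S S → P x t)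
  ∈-bound (atom _) P t₀ join d = t₀ , λ _ ()
  ∈-bound (opts (y ∷ ys)) P t₀ join d = go (y ∷ ys) d
    where
    go : ∀ xs → (∀ x → x ∈ xs → ∃[ t ] P x t) → ∃[ t ] (∀ x → x ∈ xs → P x t)
    go [] d = t₀ , λ _ ()
    go (x ∷ xs) d with d x (here refl) | go xs (λ z m → d z (there m))
    ... | a , pa | b , pb = let (c , ac , bc) = join a b in
      c , λ { z (here refl) → ac z pa ; z (there m) → bc z (pb z m) }

  -- Stops

  max-le : ∀ x y → x ≤ max x y × y ≤ max x y × (max x y ≡ x ⊎ max x y ≡ y)
  max-le x y with x ≤? y
  ... | yes a = a , ≤-refl , inj₂ refl
  ... | no n = ≤-refl , ≰⇒le L n , inj₁ refl

  min-le : ∀ x y → min x y ≤ x × min x y ≤ y × (min x y ≡ x ⊎ min x y ≡ y)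
  min-le x y with x ≤? y
  ... | yes a = ≤-refl , a , inj₁ refl
  ... | no n = ≰⇒le L n , ≤-refl , inj₂ refl

  maxRs-bound : ∀ A As {x} → x ∈ A ∷ As → Rs x ≤ maxRs A As
  maxRs-bound A [] (here refl) = ≤-refl
  maxRs-bound A (B ∷ Bs) (here refl) = proj₁ (max-le (Rs A) (maxRs B Bs))
  maxRs-bound A (B ∷ Bs) (there m) =
    ≤-trans (maxRs-bound B Bs m) (proj₁ (proj₂ (max-le (Rs A) (maxRs B Bs))))

  minLs-bound : ∀ A As {x} → x ∈ A ∷ As → minLs A As ≤ Ls x
  minLs-bound A [] (here refl) = ≤-refl
  minLs-bound A (B ∷ Bs) (here refl) = proj₁ (min-le (Ls A) (minLs B Bs))
  minLs-bound A (B ∷ Bs) (there m) =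
    ≤-trans (proj₁ (proj₂ (min-le (Ls A) (minLs B Bs)))) (minLs-bound B Bs m)

  maxRs-attained : ∀ A As → ∃[ x ] (x ∈ A ∷ As × maxRs A As ≡ Rs x)
  maxRs-attained A [] = A , here refl , refl
  maxRs-attained A (B ∷ Bs) with proj₂ (proj₂ (max-le (Rs A) (maxRs B Bs))) | maxRs-attained B Bs
  ... | inj₁ e | _ = A , here refl , e
  ... | inj₂ e | x , m , e′ = x , there m , trans e e′

  minLs-attained : ∀ A As → ∃[ x ] (x ∈ A ∷ As × minLs A As ≡ Ls x)
  minLs-attained A [] = A , here refl , refl
  minLs-attained A (B ∷ Bs) with proj₂ (proj₂ (min-le (Ls A) (minLs B Bs))) | minLs-attained B Bs
  ... | inj₁ e | _ = A , here refl , e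
  ... | inj₂ e | x , m , e′ = x , there m , trans e e′

  stop-option : ∀ {p q} → Opp p q → ∀ G {A} → A ∈[ p ] G → le p (stop q A) (stop p G)
  stop-option LR ⟨ opts (A ∷ As) ∣ _ ⟩ m = maxRs-bound A As m
  stop-option RL ⟨ _ ∣ opts (A ∷ As) ⟩ m = minLs-bound A As m

  stop-view : ∀ {p q} → Opp p q → ∀ G →
    (∃[ s ] (side p G ≡ atom s × stop p G ≡ s)) ⊎
    (∃[ A ] (A ∈[ p ] G × stop p G ≡ stop q A))
  stop-view LR ⟨ atom s ∣ _ ⟩ = inj₁ (s , refl , refl)
  stop-view LR ⟨ opts (A ∷ As) ∣ _ ⟩ = inj₂ (maxRs-attained A As)
  stop-view RL ⟨ _ ∣ atom s ⟩ = inj₁ (s , refl , refl)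
  stop-view RL ⟨ _ ∣ opts (A ∷ As) ⟩ = inj₂ (minLs-attained A As)

  -- Options and stops of sums.

  sumR≡sumL : ∀ a b G H → sumR a b G H ≡ sumL a b G H
  sumR≡sumL (atom _) (atom _) G H = refl
  sumR≡sumL (atom _) (opts _) G H = refl
  sumR≡sumL (opts _) (atom _) G H = refl
  sumR≡sumL (opts _) (opts _) G H = refl

  side-⊕ : ∀ p G H → side p (G ⊕ H) ≡ sumL (side p G) (side p H) G H
  side-⊕ L ⟨ _ ∣ _ ⟩ ⟨ _ ∣ _ ⟩ = refl
  side-⊕ R ⟨ a ∣ b ⟩ ⟨ c ∣ d ⟩ = sumR≡sumL b d _ _

  ∈-addL′ : ∀ G hs {B} → B ∈ hs → G ⊕ B ∈ addL′ G hs
  ∈-addL′ G (h ∷ hs) (here refl) = here refl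
  ∈-addL′ G (h ∷ hs) (there m) = there (∈-addL′ G hs m)

  ∈-addR′ : ∀ gs H {A} → A ∈ gs → A ⊕ H ∈ addR′ gs H
  ∈-addR′ (g ∷ gs) H (here refl) = here refl
  ∈-addR′ (g ∷ gs) H (there m) = there (∈-addR′ gs H m)

  ∈-addL′⁻ : ∀ G hs {Z} → Z ∈ addL′ G hs → ∃[ B ] (B ∈ hs × Z ≡ G ⊕ B)
  ∈-addL′⁻ G (h ∷ hs) (here refl) = h , here refl , refl
  ∈-addL′⁻ G (h ∷ hs) (there m) = let (B , n , e) = ∈-addL′⁻ G hs m in B , there n , e

  ∈-addR′⁻ : ∀ gs H {Z} → Z ∈ addR′ gs H → ∃[ A ] (A ∈ gs × Z ≡ A ⊕ H)
  ∈-addR′⁻ (g ∷ gs) H (here refl) = g , here refl , refl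
  ∈-addR′⁻ (g ∷ gs) H (there m) = let (B , n , e) = ∈-addR′⁻ gs H m in B , there n , e

  ∈-sumLˡ : ∀ a b G H {A} → A ∈S a → (A ⊕ H) ∈S sumL a b G H
  ∈-sumLˡ (opts (g ∷ gs)) (atom _) G H m = ∈-addR′ (g ∷ gs) H m
  ∈-sumLˡ (opts (g ∷ gs)) (opts (h ∷ hs)) G H m = ∈-++⁺ˡ (∈-addR′ (g ∷ gs) H m)

  ∈-sumLʳ : ∀ a b G H {B} → B ∈S b → (G ⊕ B) ∈S sumL a b G H
  ∈-sumLʳ (atom _) (opts (h ∷ hs)) G H m = ∈-addL′ G (h ∷ hs) m
  ∈-sumLʳ (opts (g ∷ gs)) (opts (h ∷ hs)) G H m = ∈-++⁺ʳ (addR′ (g ∷ gs) H) (∈-addL′ G (h ∷ hs) m)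

  ∈-sumL⁻ : ∀ a b G H {Z} → Z ∈S sumL a b G H →
    (∃[ A ] (A ∈S a × Z ≡ A ⊕ H)) ⊎ (∃[ B ] (B ∈S b × Z ≡ G ⊕ B))
  ∈-sumL⁻ (atom _) (opts (h ∷ hs)) G H m = inj₂ (∈-addL′⁻ G (h ∷ hs) m)
  ∈-sumL⁻ (opts (g ∷ gs)) (atom _) G H m = inj₁ (∈-addR′⁻ (g ∷ gs) H m)
  ∈-sumL⁻ (opts (g ∷ gs)) (opts (h ∷ hs)) G H m with ∈-++⁻ (addR′ (g ∷ gs) H) m
  ... | inj₁ n = inj₁ (∈-addR′⁻ (g ∷ gs) H n)
  ... | inj₂ n = inj₂ (∈-addL′⁻ G (h ∷ hs) n)

  sumL-atom⁻ : ∀ a b G H {s} → sumL a b G H ≡ atom s →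
    ∃[ x ] ∃[ y ] (a ≡ atom x × b ≡ atom y × s ≡ x + y)
  sumL-atom⁻ (atom x) (atom y) G H refl = x , y , refl , refl , refl
  sumL-atom⁻ (atom _) (opts _) G H ()
  sumL-atom⁻ (opts _) (atom _) G H ()
  sumL-atom⁻ (opts _) (opts _) G H ()

  ∈-⊕ˡ : ∀ p G H {A} → A ∈[ p ] G → A ⊕ H ∈[ p ] G ⊕ H
  ∈-⊕ˡ p G H m = subst (_ ∈S_) (sym (side-⊕ p G H)) (∈-sumLˡ (side p G) (side p H) G H m)

  ∈-⊕ʳ : ∀ p G H {B} → B ∈[ p ] H → G ⊕ B ∈[ p ] G ⊕ H
  ∈-⊕ʳ p G H m = subst (_ ∈S_) (sym (side-⊕ p G H)) (∈-sumLʳ (side p G) (side p H) G H m)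

  ∈-⊕⁻ : ∀ p G H {Z} → Z ∈[ p ] G ⊕ H →
    (∃[ A ] (A ∈[ p ] G × Z ≡ A ⊕ H)) ⊎ (∃[ B ] (B ∈[ p ] H × Z ≡ G ⊕ B))
  ∈-⊕⁻ p G H m = ∈-sumL⁻ (side p G) (side p H) G H (subst (_ ∈S_) (side-⊕ p G H) m)

  side-⊕-atom : ∀ p G H {a b} → side p G ≡ atom a → side p H ≡ atom b →
    side p (G ⊕ H) ≡ atom (a + b)
  side-⊕-atom p G H ea eb = trans (side-⊕ p G H) (cong₂ (λ x y → sumL x y G H) ea eb)

  side-⊕-atom⁻ : ∀ p G H {s} → side p (G ⊕ H) ≡ atom s →
    ∃[ x ] ∃[ y ] (side p G ≡ atom x × side p H ≡ atom y × s ≡ x + y)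
  side-⊕-atom⁻ p G H e = sumL-atom⁻ (side p G) (side p H) G H (trans (sym (side-⊕ p G H)) e)

  data StopSum (p q : Player) (G H : Game) : Set where
    atoms : ∀ {a b} → side p G ≡ atom a → side p H ≡ atom b →
      stop p (G ⊕ H) ≡ a + b → StopSum p q G H
    left : ∀ {A} → A ∈[ p ] G → stop p (G ⊕ H) ≡ stop q (A ⊕ H) → StopSum p q G H
    right : ∀ {B} → B ∈[ p ] H → stop p (G ⊕ H) ≡ stop q (G ⊕ B) → StopSum p q G H

  stop-⊕ : ∀ {p q} → Opp p q → ∀ G H → StopSum p q G H
  stop-⊕ {p} o G H with stop-view o (G ⊕ H)
  ... | inj₁ (s , e , e′) = let (x , y , ex , ey , exy) = side-⊕-atom⁻ p G H e in
    atoms ex ey (trans e′ exy)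
  ... | inj₂ (Z , m , e) with ∈-⊕⁻ p G H m
  ...   | inj₁ (A , n , refl) = left n e
  ...   | inj₂ (B , n , refl) = right n e

  stop-⊕-atoms : ∀ {p q} → Opp p q → ∀ G H {a b} → side p G ≡ atom a → side p H ≡ atom b →
    stop p (G ⊕ H) ≡ a + b
  stop-⊕-atoms o G H ea eb with stop-⊕ o G H
  ... | atoms ea′ eb′ e = trans e (cong₂ _+_ (atom-injective (trans (sym ea′) ea))
                                            (atom-injective (trans (sym eb′) eb)))
  ... | left m _ = ∈-atom ea m
  ... | right m _ = ∈-atom eb m

  stop-⊕ˡ : ∀ {p q} → Opp p q → ∀ G H {A} → A ∈[ p ] G → le p (stop q (A ⊕ H)) (stop p (G ⊕ H))
  stop-⊕ˡ {p} o G H m = stop-option o (G ⊕ H) (∈-⊕ˡ p G H m)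

  stop-⊕ʳ : ∀ {p q} → Opp p q → ∀ G H {B} → B ∈[ p ] H → le p (stop q (G ⊕ B)) (stop p (G ⊕ H))
  stop-⊕ʳ {p} o G H m = stop-option o (G ⊕ H) (∈-⊕ʳ p G H m)

  stop-⊕ˡ′ : ∀ {p q} → Opp p q → ∀ G H {A} → A ∈[ q ] G → le p (stop q (G ⊕ H)) (stop p (A ⊕ H))
  stop-⊕ˡ′ o G H m = le-flip (opp-sym o) (stop-⊕ˡ (opp-sym o) G H m)

  stop-⊕ʳ′ : ∀ {p q} → Opp p q → ∀ G H {B} → B ∈[ q ] H → le p (stop q (G ⊕ H)) (stop p (G ⊕ B))
  stop-⊕ʳ′ o G H m = le-flip (opp-sym o) (stop-⊕ʳ (opp-sym o) G H m)

  -- Atoms and guaranteed games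

  LB : Player → ℝ → Game → Set
  LB p s G = ∀ t → Occurs t G → le p s t

  occurs-side : ∀ p {G s} → side p G ≡ atom s → Occurs s G
  occurs-side L e = _ , here , inj₁ e
  occurs-side R e = _ , here , inj₂ e

  occurs-option : ∀ p {G A s} → A ∈[ p ] G → Occurs s A → Occurs s G
  occurs-option p m (K , f , a) = K , via p m f , a

  occurs-view : ∀ {s G} → Occurs s G →
    (∃[ p ] side p G ≡ atom s) ⊎ (∃[ p ] ∃[ A ] (A ∈[ p ] G × Occurs s A))
  occurs-view (K , here , inj₁ e) = inj₁ (L , e)
  occurs-view (K , here , inj₂ e) = inj₁ (R , e)
  occurs-view (K , viaL m f , a) = inj₂ (L , _ , m , K , f , a)
  occurs-view (K , viaR m f , a) = inj₂ (R , _ , m , K , f , a)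

  LB-option : ∀ p r {s G A} → LB p s G → A ∈[ r ] G → LB p s A
  LB-option p r lb m t o = lb t (occurs-option r m o)

  abstract
    LB-exists : ∀ p G → ∃[ s ] LB p s G
    LB-exists p = game-ind (λ G → ∃[ s ] LB p s G) λ G ih →
      let (b , hb) = bound L G ih
          (c , hc) = bound R G ih
          (d , hd) = atomBound (side L G)
          (e , he) = atomBound (side R G)
          (f , fb , fc) = meet p b c
          (g , gd , ge) = meet p d e
          (h , hf , hg) = meet p f g
      in h , λ t occ → [ (λ { (L , eq) → le-trans p hg (le-trans p gd (hd eq))
                            ; (R , eq) → le-trans p hg (le-trans p ge (he eq)) })
                       , (λ { (L , A , m , o) → le-trans p hf (le-trans p fb (hb A m t o))
                            ; (R , A , m , o) → le-trans p hf (le-trans p fc (hc A m t o)) })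
                       ]′ (occurs-view occ)
      where
      bound : ∀ r G → (∀ r A → A ∈[ r ] G → ∃[ s ] LB p s A) →
        ∃[ s ] (∀ A → A ∈[ r ] G → LB p s A)
      bound r G ih = ∈-bound (side r G) (λ A s → LB p s A) 0#
        (λ a b → let (c , ca , cb) = meet p a b in
           c , (λ x h t o → le-trans p ca (h t o)) , (λ x h t o → le-trans p cb (h t o)))
        (ih r)
      atomBound : ∀ S → ∃[ s ] (∀ {t} → S ≡ atom t → le p s t)
      atomBound (atom x) = x , λ { refl → le-refl p }
      atomBound (opts _) = 0# , λ ()

  -- Whoever moves, play of the sum ends at an atom of G plus an atom of X.
  LB-stop : ∀ p {a b} G X → LB p a G → LB p b X → ∀ r → le p (a + b) (stop r (G ⊕ X))
  LB-stop p {a} {b} = game-ind₂ P λ G X ihG ihX la lb →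
    λ { L → step G X ihG ihX la lb LR (stop-⊕ LR G X)
      ; R → step G X ihG ihX la lb RL (stop-⊕ RL G X) }
    where
    P : Game → Game → Set
    P G X = LB p a G → LB p b X → ∀ r → le p (a + b) (stop r (G ⊕ X))
    step : ∀ G X → (∀ r A → A ∈[ r ] G → P A X) → (∀ r B → B ∈[ r ] X → P G B) →
      LB p a G → LB p b X → ∀ {r s} → Opp r s → StopSum r s G X → le p (a + b) (stop r (G ⊕ X))
    step G X ihG ihX la lb {r} {s} o (atoms ea eb e) =
      subst (le p _) (sym e) (le-+ p (la _ (occurs-side r ea)) (lb _ (occurs-side r eb)))
    step G X ihG ihX la lb {r} {s} o (left m e) =
      subst (le p _) (sym e) (ihG r _ m (LB-option p r la m) lb s)
    step G X ihG ihX la lb {r} {s} o (right m e) =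
      subst (le p _) (sym e) (ihX r _ m la (LB-option p r lb m) s)

  guaranteed-follower : ∀ {G K} → Guaranteed G → Follower K G → Guaranteed K
  guaranteed-follower g f J h = g J (follower-trans h f)

  guaranteed-option : ∀ p {G A} → Guaranteed G → A ∈[ p ] G → Guaranteed A
  guaranteed-option p g m = guaranteed-follower g (via p m here)

  guaranteed-atom : ∀ p {G s} → Guaranteed G → side p G ≡ atom s → LB p s G
  guaranteed-atom L g e = proj₁ (g _ here) _ e
  guaranteed-atom R g e = proj₂ (g _ here) _ e

  mkGuaranteed : ∀ {G} → (∀ p s → side p G ≡ atom s → LB p s G) →
    (∀ p A → A ∈[ p ] G → Guaranteed A) → Guaranteed G
  mkGuaranteed a b K here = (λ ℓ e → a L ℓ e) , (λ r e → a R r e)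
  mkGuaranteed a b K (viaL m f) = b L _ m K f
  mkGuaranteed a b K (viaR m f) = b R _ m K f

  SumOccurs : Game → Game → Set
  SumOccurs G H = ∀ {s} → Occurs s (G ⊕ H) → ∃[ a ] ∃[ b ] (Occurs a G × Occurs b H × s ≡ a + b)

  occurs-⊕ : ∀ G H → SumOccurs G H
  occurs-⊕ = game-ind₂ SumOccurs (λ G H ihG ihH occ → step G H ihG ihH (occurs-view occ))
    where
    step : ∀ G H → (∀ p A → A ∈[ p ] G → SumOccurs A H) → (∀ p B → B ∈[ p ] H → SumOccurs G B) →
      ∀ {s} → (∃[ p ] side p (G ⊕ H) ≡ atom s) ⊎ (∃[ p ] ∃[ A ] (A ∈[ p ] G ⊕ H × Occurs s A)) →
      ∃[ a ] ∃[ b ] (Occurs a G × Occurs b H × s ≡ a + b)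
    step G H ihG ihH (inj₁ (p , e)) = let (x , y , ex , ey , exy) = side-⊕-atom⁻ p G H e in
      x , y , occurs-side p ex , occurs-side p ey , exy
    step G H ihG ihH (inj₂ (p , Z , m , occ)) with ∈-⊕⁻ p G H m
    ... | inj₁ (A , n , refl) = let (a , b , oa , ob , e) = ihG p A n occ in
      a , b , occurs-option p n oa , ob , e
    ... | inj₂ (B , n , refl) = let (a , b , oa , ob , e) = ihH p B n occ in
      a , b , oa , occurs-option p n ob , e

  -- An atomic side of the sum comes from two atomic sides, each extreme in its own summand, and
  -- every atom of the sum splits by `occurs-⊕`.
  guaranteed-⊕ : ∀ G H → Guaranteed G → Guaranteed H → Guaranteed (G ⊕ H)
  guaranteed-⊕ = game-ind₂ (λ G H → Guaranteed G → Guaranteed H → Guaranteed (G ⊕ H))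
    λ G H ihG ihH gG gH → mkGuaranteed
      (λ p s e t occ →
        let (x , y , ex , ey , exy) = side-⊕-atom⁻ p G H e
            (a , b , oa , ob , eab) = occurs-⊕ G H occ
        in subst₂ (le p) (sym exy) (sym eab)
             (le-+ p (guaranteed-atom p gG ex a oa) (guaranteed-atom p gH ey b ob)))
      (λ p Z m → [ (λ { (A , n , refl) → ihG p A n (guaranteed-option p gG n) gH })
                 , (λ { (B , n , refl) → ihH p B n gG (guaranteed-option p gH n) })
                 ]′ (∈-⊕⁻ p G H m))

  side-real : ∀ p s → side p (real s) ≡ atom s
  side-real L s = refl
  side-real R s = refl

  occurs-real : ∀ {s t} → Occurs t (real s) → t ≡ s
  occurs-real (_ , here , inj₁ refl) = refl
  occurs-real (_ , here , inj₂ refl) = refl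

  guaranteed-real : ∀ s → Guaranteed (real s)
  guaranteed-real s = mkGuaranteed
    (λ p t e u o → le-reflexive p (trans (atom-injective (trans (sym e) (side-real p s))) (sym (occurs-real o))))
    (λ p A m → ∈-atom (side-real p s) m)

  -- Waiting moves and pass-allowed stops

  -- -ŵ k for p = L and ŵ k for p = R: a reserve of k waiting moves for the opponent of p.
  pass : Player → ℕ → Game
  pass L k = conj (ŵ k)
  pass R k = ŵ k

  side-pass : ∀ {p q} → Opp p q → ∀ k → side p (pass p k) ≡ atom 0#
  side-pass LR zero = cong atom -0≡0
  side-pass LR (suc k) = cong atom -0≡0
  side-pass RL zero = refl
  side-pass RL (suc k) = refl

  pass-∈ : ∀ {p q} → Opp p q → ∀ k → pass p k ∈[ q ] pass p (suc k)
  pass-∈ LR k = here refl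
  pass-∈ RL k = here refl

  ∈-pass : ∀ {p q} → Opp p q → ∀ k {A} → A ∈[ q ] pass p k → ∃[ j ] (k ≡ suc j × A ≡ pass p j)
  ∈-pass LR (suc k) (here refl) = k , refl , refl
  ∈-pass RL (suc k) (here refl) = k , refl , refl

  side-pass-zero : ∀ {p q} → Opp p q → side q (pass p zero) ≡ atom 0#
  side-pass-zero LR = cong atom -0≡0
  side-pass-zero RL = refl

  occurs-pass : ∀ {p q} → Opp p q → ∀ k {s} → Occurs s (pass p k) → s ≡ 0#
  occurs-pass {p} {q} o k occ = go k (occurs-view occ)
    where
    go : ∀ k {s} → (∃[ r ] side r (pass p k) ≡ atom s) ⊎ (∃[ r ] ∃[ A ] (A ∈[ r ] pass p k × Occurs s A)) → s ≡ 0#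
    go k (inj₁ (r , e)) with opp-cases o r
    go k (inj₁ (r , e)) | inj₁ refl = atom-injective (trans (sym e) (side-pass o k))
    go zero (inj₁ (r , e)) | inj₂ refl = atom-injective (trans (sym e) (side-pass-zero o))
    go (suc k) (inj₁ (r , e)) | inj₂ refl = ∈-atom e (pass-∈ o k)
    go k (inj₂ (r , A , m , occ)) with opp-cases o r
    go k (inj₂ (r , A , m , occ)) | inj₁ refl = ∈-atom (side-pass o k) m
    go k (inj₂ (r , A , m , occ)) | inj₂ refl with ∈-pass o k m
    ... | j , refl , refl = go j (occurs-view occ)

  guaranteed-pass : ∀ {p q} → Opp p q → ∀ k → Guaranteed (pass p k)
  guaranteed-pass {p} o zero = mkGuaranteed
    (λ r s e t occ → le-reflexive r
      (trans (occurs-pass o zero (occurs-side r e)) (sym (occurs-pass o zero occ))))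
    (λ r A m → [ (λ { refl → ∈-atom (side-pass o zero) m })
               , (λ { refl → ∈-atom (side-pass-zero o) m }) ]′ (opp-cases o r))
  guaranteed-pass {p} o (suc k) = mkGuaranteed
    (λ r s e t occ → le-reflexive r
      (trans (occurs-pass o (suc k) (occurs-side r e)) (sym (occurs-pass o (suc k) occ))))
    (λ r A m → [ (λ { refl → ∈-atom (side-pass o (suc k)) m })
               , (λ { refl → prev (∈-pass o (suc k) m) }) ]′ (opp-cases o r))
    where
    prev : ∀ {A} → ∃[ j ] (suc k ≡ suc j × A ≡ pass p j) → Guaranteed A
    prev (j , refl , refl) = guaranteed-pass o k

  pstop : Player → Player → Game → ℕ → ℝ
  pstop p r G k = stop r (G ⊕ pass p k)

  pstop-atom : ∀ {p q} → Opp p q → ∀ G k {a} → side p G ≡ atom a → pstop p p G k ≡ a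
  pstop-atom {p} o G k e = trans (stop-⊕-atoms o G (pass p k) e (side-pass o k)) (+-identityʳ _)

  pstop-pass : ∀ {p q} → Opp p q → ∀ G k → le p (pstop p q G (suc k)) (pstop p p G k)
  pstop-pass {p} o G k = stop-⊕ʳ′ o G (pass p (suc k)) (pass-∈ o k)

  -- Since G is guaranteed, a is the best atom of G for p, so q loses nothing by passing where the
  -- game would otherwise end. All atoms of `pass` are 0, hence b is 0 too.
  pstop-≤-atoms : ∀ {p q} → Opp p q → ∀ G j {k a b} → Guaranteed G →
    side q G ≡ atom a → side q (pass p k) ≡ atom b → le p (pstop p q G (suc j)) (a + b)
  pstop-≤-atoms {p} {q} o G j {k} {a} {b} g ea eb = le-trans p (pstop-pass o G j)
    (le-flip (opp-sym o) (LB-stop q G (pass p j) (guaranteed-atom q g ea)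
      (λ t occ → le-reflexive q
        (trans (occurs-pass o k (occurs-side q eb)) (sym (occurs-pass o j occ)))) p))

  pstop-antitone-step : ∀ {p q} → Opp p q → ∀ G → Guaranteed G → ∀ k r →
    le p (pstop p r G (suc k)) (pstop p r G k)
  pstop-antitone-step {p} {q} o = game-ind P λ G ih g k r →
    [ (λ { refl → own G ih g k (stop-⊕ o G (pass p (suc k))) })
    , (λ { refl → other G ih g k (stop-⊕ (opp-sym o) G (pass p k)) }) ]′ (opp-cases o r)
    where
    P : Game → Set
    P G = Guaranteed G → ∀ k r → le p (pstop p r G (suc k)) (pstop p r G k)
    own : ∀ G → (∀ r A → A ∈[ r ] G → P A) → Guaranteed G → ∀ k → StopSum p q G (pass p (suc k)) →
      le p (pstop p p G (suc k)) (pstop p p G k)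
    own G ih g k (atoms ea eb e) =
      le-reflexive p (trans (pstop-atom o G (suc k) ea) (sym (pstop-atom o G k ea)))
    own G ih g k (left m e) = le-trans p (le-reflexive p e)
      (le-trans p (ih p _ m (guaranteed-option p g m) k q) (stop-⊕ˡ o G (pass p k) m))
    own G ih g k (right m e) = ∈-atom (side-pass o (suc k)) m
    other : ∀ G → (∀ r A → A ∈[ r ] G → P A) → Guaranteed G → ∀ k → StopSum q p G (pass p k) →
      le p (pstop p q G (suc k)) (pstop p q G k)
    other G ih g k (atoms ea eb e) =
      le-trans p (pstop-≤-atoms o G k {k} g ea eb) (le-reflexive p (sym e))
    other G ih g k (left m e) = le-trans p (stop-⊕ˡ′ o G (pass p (suc k)) m)
      (le-trans p (ih q _ m (guaranteed-option q g m) k p) (le-reflexive p (sym e)))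
    other G ih g k (right m e) with ∈-pass o k m
    ... | j , refl , refl = le-trans p (pstop-pass o G (suc j))
      (le-trans p (own G ih g j (stop-⊕ o G (pass p (suc j)))) (le-reflexive p (sym e)))

  pstop-antitone : ∀ {p q} → Opp p q → ∀ G → Guaranteed G → ∀ r {j k} → j ℕ.≤ k →
    le p (pstop p r G k) (pstop p r G j)
  pstop-antitone {p} o G g r j≤k = go (ℕₚ.≤⇒≤′ j≤k)
    where
    go : ∀ {j k} → j ℕ.≤′ k → le p (pstop p r G k) (pstop p r G j)
    go ℕ.≤′-refl = le-refl p
    go (ℕ.≤′-step h) = le-trans p (pstop-antitone-step o G g _ r) (go h)

  -- Guaranteedness is packed in because raising N to a common index in `stable-options` needs
  -- antitonicity.
  Stable : Player → Player → Game → ℕ → Set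
  Stable p r G N = Guaranteed G × (∀ k → le p (pstop p r G N) (pstop p r G k))

  stable-options : ∀ {p q} → Opp p q → ∀ S r →
    (∀ A → A ∈S S → ∃[ N ] Stable p r A N) → ∃[ N ] (∀ A → A ∈S S → Stable p r A N)
  stable-options {p} o S r = ∈-bound S (Stable p r) 0 λ a b → a ℕ.⊔ b ,
    (λ { x (g , h) → g , λ k → le-trans p (pstop-antitone o x g r (ℕₚ.m≤m⊔n a b)) (h k) }) ,
    (λ { x (g , h) → g , λ k → le-trans p (pstop-antitone o x g r (ℕₚ.m≤n⊔m a b)) (h k) })

  abstract
    -- A decreasing sequence of reals need not become constant, so the index is built along the
    -- tree. With all options stable at N, the option attaining the p-stop at N already has its
    -- least value there, and this bounds the p-stop at every k.
    stable : ∀ {p q} → Opp p q → ∀ G → Guaranteed G → ∀ r → ∃[ N ] Stable p r G N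
    stable {p} {q} o = game-ind P λ G ih g r →
      [ (λ { refl → own G ih g }) , (λ { refl → other G ih g }) ]′ (opp-cases o r)
      where
      P : Game → Set
      P G = Guaranteed G → ∀ r → ∃[ N ] Stable p r G N
      own : ∀ G → (∀ r A → A ∈[ r ] G → P A) → Guaranteed G → ∃[ N ] Stable p p G N
      own G ih g with stable-options o (side p G) q (λ A m → ih p A m (guaranteed-option p g m) q)
      ... | N , h with stop-⊕ o G (pass p N)
      ... | atoms ea eb e = N , g , λ k →
        le-reflexive p (trans (pstop-atom o G N ea) (sym (pstop-atom o G k ea)))
      ... | left m e = N , g , λ k → le-trans p (le-reflexive p e)
        (le-trans p (proj₂ (h _ m) k) (stop-⊕ˡ o G (pass p k) m))
      ... | right m e = ∈-atom (side-pass o N) m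
      other : ∀ G → (∀ r A → A ∈[ r ] G → P A) → Guaranteed G → ∃[ N ] Stable p q G N
      other G ih g with own G ih g
                      | stable-options o (side q G) p (λ A m → ih q A m (guaranteed-option q g m) p)
      -- The extra unit pays for a pass by q, after which N₁ or more waiting moves must be left.
      ... | N₁ , _ , h₁ | N₂ , h₂ = suc (N₁ ℕ.⊔ N₂) , g , λ k → go k (stop-⊕ (opp-sym o) G (pass p k))
        where
        go : ∀ k → StopSum q p G (pass p k) →
          le p (pstop p q G (suc (N₁ ℕ.⊔ N₂))) (pstop p q G k)
        go k (atoms ea eb e) =
          le-trans p (pstop-≤-atoms o G _ {k} g ea eb) (le-reflexive p (sym e))
        go k (left {A} m e) = le-trans p (stop-⊕ˡ′ o G (pass p (suc (N₁ ℕ.⊔ N₂))) m)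
          (le-trans p (pstop-antitone o A (proj₁ (h₂ A m)) p
                        (ℕₚ.≤-trans (ℕₚ.m≤n⊔m N₁ N₂) (ℕₚ.n≤1+n _)))
            (le-trans p (proj₂ (h₂ A m) k) (le-reflexive p (sym e))))
        go k (right m e) with ∈-pass o k m
        ... | j , refl , refl = le-trans p (pstop-pass o G (N₁ ℕ.⊔ N₂))
          (le-trans p (pstop-antitone o G g p (ℕₚ.m≤m⊔n N₁ N₂))
            (le-trans p (h₁ j) (le-reflexive p (sym e))))

  -- One move of p works against every number of passes: it is the best move at an index where all
  -- options have settled.
  pstop-pick : ∀ {p q} → Opp p q → ∀ G → Guaranteed G → ∀ v → (∀ k → le p v (pstop p p G k)) →
    (∃[ a ] (side p G ≡ atom a × le p v a)) ⊎
    (∃[ A ] (A ∈[ p ] G × (∀ k → le p v (pstop p q A k))))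
  pstop-pick {p} {q} o G g v h
    with stable-options o (side p G) q (λ A m → stable o A (guaranteed-option p g m) q)
  ... | N , hN with stop-⊕ o G (pass p N)
  ... | atoms ea eb e = inj₁ (_ , ea , subst (le p v) (pstop-atom o G N ea) (h N))
  ... | left m e = inj₂ (_ , m , λ k →
    le-trans p (h N) (le-trans p (le-reflexive p e) (proj₂ (hN _ m) k)))
  ... | right m e = ∈-atom (side-pass o N) m

  -- The player treats the opponent's moves in X as waiting moves and answers in G.
  pstop-bound : ∀ {p q} → Opp p q → ∀ {x} G X → Guaranteed G → LB p x X → ∀ r v →
    (∀ k → le p v (pstop p r G k)) → le p (v + x) (stop r (G ⊕ X))
  pstop-bound {p} {q} o {x} = game-ind₂ P λ G X ihG ihX g lb r v h →
    [ (λ { refl → own G X ihG g lb v (pstop-pick o G g v h) })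
    , (λ { refl → other G X ihG ihX g lb v h (stop-⊕ (opp-sym o) G X) }) ]′ (opp-cases o r)
    where
    P : Game → Game → Set
    P G X = Guaranteed G → LB p x X → ∀ r v →
      (∀ k → le p v (pstop p r G k)) → le p (v + x) (stop r (G ⊕ X))
    own : ∀ G X → (∀ r A → A ∈[ r ] G → P A X) → Guaranteed G → LB p x X → ∀ v →
      (∃[ a ] (side p G ≡ atom a × le p v a)) ⊎
      (∃[ A ] (A ∈[ p ] G × (∀ k → le p v (pstop p q A k)))) → le p (v + x) (stop p (G ⊕ X))
    own G X ihG g lb v (inj₁ (a , e , v≤a)) =
      le-trans p (le-+ p v≤a (le-refl p)) (LB-stop p G X (guaranteed-atom p g e) lb p)
    own G X ihG g lb v (inj₂ (A , m , h)) =
      le-trans p (ihG p A m (guaranteed-option p g m) lb q v h) (stop-⊕ˡ o G X m)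
    other : ∀ G X → (∀ r A → A ∈[ r ] G → P A X) → (∀ r B → B ∈[ r ] X → P G B) →
      Guaranteed G → LB p x X → ∀ v → (∀ k → le p v (pstop p q G k)) → StopSum q p G X →
      le p (v + x) (stop q (G ⊕ X))
    other G X ihG ihX g lb v h (atoms ea eb e) = subst (le p _) (sym e)
      (le-+ p
        (subst (le p v)
          (trans (stop-⊕-atoms (opp-sym o) G (pass p 0) ea (side-pass-zero o)) (+-identityʳ _)) (h 0))
        (lb _ (occurs-side q eb)))
    other G X ihG ihX g lb v h (left m e) = subst (le p _) (sym e)
      (ihG q _ m (guaranteed-option q g m) lb p v
        λ k → le-trans p (h k) (stop-⊕ˡ′ o G (pass p k) m))
    other G X ihG ihX g lb v h (right m e) = subst (le p _) (sym e)
      (ihX q _ m g (LB-option p q lb m) p v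
        λ k → le-trans p (h (suc k)) (pstop-pass o G k))

  -- Comparison of games

  Ge : Player → Game → Game → Set
  Ge L G H = G ≽ H
  Ge R G H = H ≽ G

  ge-stop : ∀ p {G H} → Ge p G H → ∀ X → Guaranteed X → ∀ r → le p (stop r (H ⊕ X)) (stop r (G ⊕ X))
  ge-stop L h X g L = proj₁ (h X g)
  ge-stop L h X g R = proj₂ (h X g)
  ge-stop R h X g L = proj₁ (h X g)
  ge-stop R h X g R = proj₂ (h X g)

  mkGe : ∀ p {G H} → (∀ X → Guaranteed X → ∀ r → le p (stop r (H ⊕ X)) (stop r (G ⊕ X))) → Ge p G H
  mkGe L h X g = h X g L , h X g R
  mkGe R h X g = h X g L , h X g R

  ge-flip : ∀ {p q G H} → Opp p q → Ge p G H → Ge q H G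
  ge-flip LR h = h
  ge-flip RL h = h

  ge-trans : ∀ p {G H K} → Ge p G H → Ge p H K → Ge p G K
  ge-trans p a b = mkGe p λ X g r → le-trans p (ge-stop p b X g r) (ge-stop p a X g r)

  -- This half controls the stops with p to move; `Half q p H G` controls those with q to move, and
  -- together they characterise `Ge p G H`.
  record Half (p q : Player) (G H : Game) : Set where
    field
      atomic : ∀ h → side p H ≡ atom h → ∀ k → le p h (pstop p p G k)
      answer : ∀ A → A ∈[ p ] H →
        (∃[ C ] (C ∈[ p ] G × Ge p C A)) ⊎ (∃[ B ] (B ∈[ q ] A × Ge p G B))

  -- If p is stuck in both H and X, the score is h plus the atom b of X. In G ⊕ X, p secures the
  -- pass-allowed stop of G, at least h, plus the worst atom of X, which is b because X is
  -- guaranteed.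
  half-sound : ∀ {p q} → Opp p q → ∀ G H X → Half p q G H → Guaranteed G → Guaranteed X →
    (∀ Y → Y ∈[ p ] X → le p (stop q (H ⊕ Y)) (stop q (G ⊕ Y))) →
    le p (stop p (H ⊕ X)) (stop p (G ⊕ X))
  half-sound {p} {q} o G H X hf gG gX ih with stop-⊕ o H X
  ... | atoms ea eb e = subst (λ z → le p z (stop p (G ⊕ X))) (sym e)
    (pstop-bound o G X gG (guaranteed-atom p gX eb) p _ (Half.atomic hf _ ea))
  ... | right m e = le-trans p (le-reflexive p e) (le-trans p (ih _ m) (stop-⊕ʳ o G X m))
  ... | left m e with Half.answer hf _ m
  ...   | inj₁ (C , n , h) = le-trans p (le-reflexive p e)
    (le-trans p (ge-stop p h X gX q) (stop-⊕ˡ o G X n))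
  ...   | inj₂ (B , n , h) = le-trans p (le-reflexive p e)
    (le-trans p (stop-⊕ˡ′ o _ X n) (ge-stop p h X gX p))

  ge-sound : ∀ {p q} → Opp p q → ∀ G H → Guaranteed G → Guaranteed H →
    Half p q G H → Half q p H G → Ge p G H
  ge-sound {p} {q} o G H gG gH h₁ h₂ = mkGe p (game-ind P λ X ih gX r →
    [ (λ { refl → half-sound o G H X h₁ gG gX λ Y m → ih p Y m (guaranteed-option p gX m) q })
    , (λ { refl → le-flip (opp-sym o) (half-sound (opp-sym o) H G X h₂ gH gX
           λ Y m → le-flip o (ih q Y m (guaranteed-option q gX m) p)) })
    ]′ (opp-cases o r))
    where
    P : Game → Set
    P X = Guaranteed X → ∀ r → le p (stop r (H ⊕ X)) (stop r (G ⊕ X))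

  -- Separating games

  Dist : Player → Player → Game → Game → Set
  Dist p r G H = ∃[ X ] (Guaranteed X × ¬ le p (stop r (H ⊕ X)) (stop r (G ⊕ X)))

  dist⇒¬ge : ∀ p r {G H} → Dist p r G H → ¬ Ge p G H
  dist⇒¬ge p r (X , gX , n) h = n (ge-stop p h X gX r)

  dist-flip : ∀ {p q} → Opp p q → ∀ r {G H} → Dist p r G H → Dist q r H G
  dist-flip o r (X , gX , n) = X , gX , λ h → n (le-flip (opp-sym o) h)

  ∈-node : ∀ {p q} → Opp p q → ∀ a b {A} → A ∈S a → A ∈[ p ] node p a b
  ∈-node o a b = subst (_ ∈S_) (sym (side-node o a b))

  ∈-node′ : ∀ {p q} → Opp p q → ∀ a b {A} → A ∈S b → A ∈[ q ] node p a b
  ∈-node′ o a b = subst (_ ∈S_) (sym (side-node′ o a b))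

  ∈-node⁻ : ∀ {p q} → Opp p q → ∀ a b {A} → A ∈[ p ] node p a b → A ∈S a
  ∈-node⁻ o a b = subst (_ ∈S_) (side-node o a b)

  ∈-node′⁻ : ∀ {p q} → Opp p q → ∀ a b {A} → A ∈[ q ] node p a b → A ∈S b
  ∈-node′⁻ o a b = subst (_ ∈S_) (side-node′ o a b)

  guaranteed-node : ∀ {p q} → Opp p q → ∀ a b →
    (∀ s → a ≡ atom s → LB p s (node p a b)) → (∀ s → b ≡ atom s → LB q s (node p a b)) →
    (∀ A → A ∈S a → Guaranteed A) → (∀ A → A ∈S b → Guaranteed A) → Guaranteed (node p a b)
  guaranteed-node {p} o a b ha hb ga gb = mkGuaranteed
    (λ r s e → [ (λ { refl → ha s (trans (sym (side-node o a b)) e) })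
               , (λ { refl → hb s (trans (sym (side-node′ o a b)) e) }) ]′ (opp-cases o r))
    (λ r A m → [ (λ { refl → ga A (∈-node⁻ o a b m) })
               , (λ { refl → gb A (∈-node′⁻ o a b m) }) ]′ (opp-cases o r))

  -- Prefixing X by a move of q turns a p-stop into a q-stop; the threat to move to
  -- a large real forces q to play to X at once.
  dist-convert : ∀ {p q} → Opp p q → ∀ {G H} → Dist p p G H → Dist p q G H
  dist-convert {p} {q} o {G} {H} (X , gX , n) = Y , gY , λ h → n
    (le-trans p (threat (stop-⊕ (opp-sym o) H Y))
      (le-trans p h (stop-⊕ʳ′ o G Y X∈Y)))
    where
    c b m : ℝ
    c = stop p (H ⊕ X)
    b = proj₁ (LB-exists p H)
    -- As b bounds the atoms of H from below for p, once p has reached `real m` every ending gives p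
    -- at least c.
    m = - b + c
    l r : Side
    l = opts List⁺.[ real m ]
    r = opts List⁺.[ X ]
    Y : Game
    Y = node p l r
    X∈Y : X ∈[ q ] Y
    X∈Y = ∈-node′ o l r (here refl)
    gY : Guaranteed Y
    gY = guaranteed-node o l r (λ _ ()) (λ _ ())
      (λ { _ (here refl) → guaranteed-real m }) (λ { _ (here refl) → gX })
    threat : StopSum q p H Y → le p c (stop q (H ⊕ Y))
    threat (atoms ea eb e) = ∈-atom eb X∈Y
    threat (left {A} k e) = subst (le p c) (sym e)
      (le-trans p (subst (λ z → le p z (stop q (A ⊕ real m))) (+-cancel b c)
          (LB-stop p A (real m) (LB-option p q (proj₂ (LB-exists p H)) k)
            (λ t o → le-reflexive p (sym (occurs-real o))) q))
        (stop-⊕ʳ o A Y (∈-node o l r (here refl))))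
    threat (right k e) with ∈-node′⁻ o l r k
    ... | here refl = le-reflexive p (sym e)

  -- Lets a failure of either half be reported with p to move.
  dist-own : ∀ {p q} → Opp p q → ∀ {G H} → Dist q q H G → Dist p p G H
  dist-own {p} o d = dist-flip (opp-sym o) p (dist-convert (opp-sym o) d)

  shift-le : ∀ {p q} → Opp p q → ∀ a G X r →
    le p (stop r (G ⊕ X) + a) (stop r (G ⊕ (X ⊕ real a)))
  shift-le {p} {q} o a = game-ind₂ P λ G X ihG ihX r →
    [ (λ { refl → own G X ihG ihX (stop-⊕ o G X) })
    , (λ { refl → other G X ihG ihX (stop-⊕ (opp-sym o) G (X ⊕ real a)) }) ]′ (opp-cases o r)
    where
    P : Game → Game → Set
    P G X = ∀ r → le p (stop r (G ⊕ X) + a) (stop r (G ⊕ (X ⊕ real a)))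
    own : ∀ G X → (∀ r A → A ∈[ r ] G → P A X) → (∀ r B → B ∈[ r ] X → P G B) →
      StopSum p q G X → le p (stop p (G ⊕ X) + a) (stop p (G ⊕ (X ⊕ real a)))
    own G X ihG ihX (atoms {x} {y} ea eb e) = le-reflexive p
      (trans (cong (_+ a) e) (trans (+-assoc x y a)
        (sym (stop-⊕-atoms o G (X ⊕ real a) ea (side-⊕-atom p X (real a) eb (side-real p a))))))
    own G X ihG ihX (left m e) = subst (λ z → le p (z + a) _) (sym e)
      (le-trans p (ihG p _ m q) (stop-⊕ˡ o G (X ⊕ real a) m))
    own G X ihG ihX (right m e) = subst (λ z → le p (z + a) _) (sym e)
      (le-trans p (ihX p _ m q) (stop-⊕ʳ o G (X ⊕ real a) (∈-⊕ˡ p X (real a) m)))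
    other : ∀ G X → (∀ r A → A ∈[ r ] G → P A X) → (∀ r B → B ∈[ r ] X → P G B) →
      StopSum q p G (X ⊕ real a) → le p (stop q (G ⊕ X) + a) (stop q (G ⊕ (X ⊕ real a)))
    other G X ihG ihX (atoms {x} ea eb e) with side-⊕-atom⁻ q X (real a) eb
    ... | y , a′ , ey , ea′ , refl = le-reflexive p
      (trans (cong₂ _+_ (stop-⊕-atoms (opp-sym o) G X ea ey)
                        (atom-injective (trans (sym (side-real q a)) ea′)))
        (trans (+-assoc x y a′) (sym e)))
    other G X ihG ihX (left m e) = subst (le p _) (sym e)
      (le-trans p (le-+ p (stop-⊕ˡ′ o G X m) (le-refl p)) (ihG q _ m p))
    other G X ihG ihX (right m e) with ∈-⊕⁻ q X (real a) m
    ... | inj₁ (B , n , refl) = subst (le p _) (sym e)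
      (le-trans p (le-+ p (stop-⊕ʳ′ o G X n) (le-refl p)) (ihX q _ n p))
    ... | inj₂ (B , n , refl) = ∈-atom (side-real q a) n

  shift : ∀ a G X r → stop r (G ⊕ (X ⊕ real a)) ≡ stop r (G ⊕ X) + a
  shift a G X r = ≤-antisym (shift-le RL a G X r) (shift-le LR a G X r)

  -- The threshold is normalised to 0 by adding a real, so that separating games for different
  -- options can sit side by side in one game.
  Sep : Player → Player → Game → Game → Game → Set
  Sep p r G H X = Guaranteed X × ¬ le p 0# (stop r (G ⊕ X)) × le p 0# (stop r (H ⊕ X))

  dist⇒sep : ∀ p r {G H} → Dist p r G H → ∃[ X ] Sep p r G H X
  dist⇒sep p r {G} {H} (X , gX , n) =
    X ⊕ real a , guaranteed-⊕ X (real a) gX (guaranteed-real a) ,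
    (λ h → n (subst₂ (le p) (trans (+-comm 0# s) (+-identityʳ s)) back
      (le-+ p (subst (le p 0#) (shift a G X r) h) (le-refl p {s})))) ,
    le-reflexive p (sym (trans (shift a H X r) (-‿inverseʳ s)))
    where
    s a t : ℝ
    s = stop r (H ⊕ X)
    a = - s
    t = stop r (G ⊕ X)
    back : t + a + s ≡ t
    back = trans (+-assoc t a s) (trans (cong (t +_) (-‿inverseˡ s)) (+-identityʳ t))

  -- When S is an atom there is nothing to refute, and the new game needs an atom on that side;
  -- `familySide` leaves its value open.
  data Family (S : Side) (P : Game → Game → Set) : Set where
    none : ∀ {a} → S ≡ atom a → Family S P
    some : (ys : List⁺ Game) →
      (∀ B → B ∈S S → ∃[ y ] (y ∈ toList ys × P B y)) →
      (∀ y → y ∈ toList ys → ∃[ B ] (B ∈S S × P B y)) → Family S P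

  family : ∀ S {P} → (∀ B → B ∈S S → ∃[ y ] P B y) → Family S P
  family (atom a) d = none refl
  family (opts (x ∷ xs)) {P} d =
    let (y , py) = d x (here refl)
        (ys , f , g) = go xs (λ B m → d B (there m))
    in some (y ∷ ys)
         (λ { B (here refl) → y , here refl , py
            ; B (there m) → let (z , n , pz) = f B m in z , there n , pz })
         (λ { z (here refl) → x , here refl , py
            ; z (there m) → let (B , n , pz) = g z m in B , there n , pz })
    where
    go : ∀ xs → (∀ B → B ∈ xs → ∃[ y ] P B y) → ∃[ ys ]
      ((∀ B → B ∈ xs → ∃[ y ] (y ∈ ys × P B y)) × (∀ y → y ∈ ys → ∃[ B ] (B ∈ xs × P B y)))
    go [] d = [] , (λ _ ()) , (λ _ ())
    go (x ∷ xs) d =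
      let (y , py) = d x (here refl)
          (ys , f , g) = go xs (λ B m → d B (there m))
      in y ∷ ys ,
         (λ { B (here refl) → y , here refl , py
            ; B (there m) → let (z , n , pz) = f B m in z , there n , pz }) ,
         (λ { z (here refl) → x , here refl , py
            ; z (there m) → let (B , n , pz) = g z m in B , there n , pz })

  familySide : ∀ {S P} → Family S P → ℝ → Side
  familySide (none _) c = atom c
  familySide (some ys _ _) c = opts ys

  familySide-∈ : ∀ {S P} (F : Family S P) c d {A} → A ∈S familySide F c → A ∈S familySide F d
  familySide-∈ (some _ _ _) c d m = m

  familySide-atom : ∀ {S P} (F : Family S P) {c s} → familySide F c ≡ atom s → s ≡ c
  familySide-atom (none _) refl = refl

  family-∈ : ∀ {S P} (F : Family S P) c {B} → B ∈S S → ∃[ y ] (y ∈S familySide F c × P B y)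
  family-∈ (none e) c m = ∈-atom e m
  family-∈ (some _ f _) c m = f _ m

  family-∈⁻ : ∀ {S P} (F : Family S P) c {y} → y ∈S familySide F c → ∃[ B ] (B ∈S S × P B y)
  family-∈⁻ (some _ _ g) c m = g _ m

  -- The separating game is ⟨Y_B | X_C⟩: every move of G to C is refuted by X_C, every move
  -- to Y_B loses, while H moves to A and answers each B by Y_B.
  module Separate {p q} (o : Opp p q) (G A : Game)
    (dC : ∀ C → C ∈[ p ] G → ∃[ X ] Sep p p C A X)
    (dB : ∀ B → B ∈[ q ] A → ∃[ Y ] Sep p q G B Y) where

    FY : Family (side q A) (λ B Y → Sep p q G B Y)
    FY = family (side q A) dB
    FX : Family (side p G) (λ C X → Sep p p C A X)
    FX = family (side p G) dC

    -- A provisional game with atoms 0, used only to bound the atoms of the options before the true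
    -- atoms ℓ and r are fixed.
    X₀ : Game
    X₀ = node p (familySide FY 0#) (familySide FX 0#)

    lowest : ∃[ b ] LB p b X₀
    lowest = LB-exists p X₀
    highest : ∃[ u ] LB q u X₀
    highest = LB-exists q X₀
    highestG : ∃[ g ] LB q g G
    highestG = LB-exists q G
    lowestA : ∃[ a ] LB p a A
    lowestA = LB-exists p A
    losing : ∃[ y ] (∀ g → le p g (proj₁ highestG) → ¬ le p 0# (g + y))
    losing = below p (proj₁ highestG)

    -- For p, r is at least as good as every atom of `X₀`, which guaranteedness needs, and it lifts
    -- the worst atom of A to at least 0, which `A-wins` needs when q is stuck.
    hi : ∃[ r ] (le q r (proj₁ highest) × le q r (- proj₁ lowestA))
    hi = meet q (proj₁ highest) (- proj₁ lowestA)
    r : ℝ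
    r = proj₁ hi
    -- Dually, ℓ has to be no better for p than any atom of `X₀`, and so bad that even the best atom
    -- of G cannot compensate for it when p is stuck.
    lo₁ : ∃[ z ] (le p z (proj₁ lowest) × le p z (proj₁ losing))
    lo₁ = meet p (proj₁ lowest) (proj₁ losing)
    lo : ∃[ z ] (le p z (proj₁ lo₁) × le p z r)
    lo = meet p (proj₁ lo₁) r
    ℓ : ℝ
    ℓ = proj₁ lo

    sl sr : Side
    sl = familySide FY ℓ
    sr = familySide FX r
    X : Game
    X = node p sl sr

    occurs-X : ∀ {t} → Occurs t X → t ≡ ℓ ⊎ t ≡ r ⊎ Occurs t X₀
    occurs-X occ with occurs-view occ
    ... | inj₁ (s , e) with opp-cases o s
    ...   | inj₁ refl = inj₁ (familySide-atom FY (trans (sym (side-node o sl sr)) e))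
    ...   | inj₂ refl = inj₂ (inj₁ (familySide-atom FX (trans (sym (side-node′ o sl sr)) e)))
    occurs-X occ | inj₂ (s , B , m , occ′) with opp-cases o s
    ...   | inj₁ refl = inj₂ (inj₂ (occurs-option p
              (∈-node o _ _ (familySide-∈ FY ℓ 0# (∈-node⁻ o sl sr m))) occ′))
    ...   | inj₂ refl = inj₂ (inj₂ (occurs-option q
              (∈-node′ o _ _ (familySide-∈ FX r 0# (∈-node′⁻ o sl sr m))) occ′))

    ℓ≤r : le p ℓ r
    ℓ≤r = proj₂ (proj₂ lo)

    LB-ℓ : LB p ℓ X
    LB-ℓ t occ with occurs-X occ
    ... | inj₁ refl = le-refl p
    ... | inj₂ (inj₁ refl) = ℓ≤r
    ... | inj₂ (inj₂ h) = le-trans p (proj₁ (proj₂ lo))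
      (le-trans p (proj₁ (proj₂ lo₁)) (proj₂ lowest t h))

    LB-r : LB q r X
    LB-r t occ with occurs-X occ
    ... | inj₁ refl = le-flip o ℓ≤r
    ... | inj₂ (inj₁ refl) = le-refl q
    ... | inj₂ (inj₂ h) = le-trans q (proj₁ (proj₂ hi)) (proj₂ highest t h)

    gX : Guaranteed X
    gX = guaranteed-node o sl sr
      (λ s e → subst (λ z → LB p z X) (sym (familySide-atom FY e)) LB-ℓ)
      (λ s e → subst (λ z → LB q z X) (sym (familySide-atom FX e)) LB-r)
      (λ Y m → proj₁ (proj₂ (proj₂ (family-∈⁻ FY ℓ m))))
      (λ Z m → proj₁ (proj₂ (proj₂ (family-∈⁻ FX r m))))

    G-loses : StopSum p q G X → ¬ le p 0# (stop p (G ⊕ X))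
    G-loses (atoms {g} ea eb e) h = proj₂ losing g
      (le-flip (opp-sym o) (proj₂ highestG g (occurs-side p ea)))
      (le-trans p (subst (le p 0#) e h) (le-+ p (le-refl p)
        (subst (λ z → le p z _) (sym (familySide-atom FY (trans (sym (side-node o sl sr)) eb)))
          (le-trans p (proj₁ (proj₂ lo)) (proj₂ (proj₂ lo₁))))))
    G-loses (left {C} m e) h with family-∈ FX r m
    ... | Z , n , _ , bad , _ = bad
      (le-trans p (subst (le p 0#) e h) (stop-⊕ʳ′ o C X (∈-node′ o sl sr n)))
    G-loses (right m e) h with family-∈⁻ FY ℓ (∈-node⁻ o sl sr m)
    ... | B , n , _ , bad , _ = bad (subst (le p 0#) e h)

    A-wins : StopSum q p A X → le p 0# (stop q (A ⊕ X))
    A-wins (atoms {a} ea eb e) = subst (le p 0#) (sym e)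
      (subst (λ z → le p z _) (-‿inverseʳ (proj₁ lowestA))
        (le-+ p (proj₂ lowestA a (occurs-side q ea))
          (subst (le p _) (sym (familySide-atom FX (trans (sym (side-node′ o sl sr)) eb)))
            (le-flip (opp-sym o) (proj₂ (proj₂ hi))))))
    A-wins (left {B} m e) with family-∈ FY ℓ m
    ... | Y , n , _ , _ , good = subst (le p 0#) (sym e)
      (le-trans p good (stop-⊕ʳ o B X (∈-node o sl sr n)))
    A-wins (right m e) with family-∈⁻ FX r (∈-node′⁻ o sl sr m)
    ... | C , n , _ , _ , good = subst (le p 0#) (sym e) good

    dist : ∀ {H} → A ∈[ p ] H → Dist p p G H
    dist {H} m = X , gX , λ h → G-loses (stop-⊕ o G X)
      (le-trans p (A-wins (stop-⊕ (opp-sym o) A X)) (le-trans p (stop-⊕ˡ o H X m) h))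

  -- Deciding comparison.

  half-dec : ∀ {p q} → Opp p q → ∀ G H → Guaranteed G →
    (∀ C → C ∈[ p ] G → ∀ A → A ∈[ p ] H → Ge p C A ⊎ Dist p p C A) →
    (∀ A → A ∈[ p ] H → ∀ B → B ∈[ q ] A → Ge p G B ⊎ Dist p p G B) →
    Half p q G H ⊎ Dist p p G H
  half-dec {p} {q} o G H gG decC decB = combine atomic? (∈-dichotomy (side p H) answer?)
    where
    Answer : Game → Set
    Answer A = (∃[ C ] (C ∈[ p ] G × Ge p C A)) ⊎ (∃[ B ] (B ∈[ q ] A × Ge p G B))
    atomic? : Dist p p G H ⊎ (∀ h → side p H ≡ atom h → ∀ k → le p h (pstop p p G k))
    atomic? with side p H in eq
    ... | opts _ = inj₂ λ _ ()
    ... | atom h with stable o G gG p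
    ...   | N , _ , st with le? p h (pstop p p G N)
    ...     | yes a = inj₂ λ { _ refl k → le-trans p a (st k) }
    -- N waiting moves for q separate the games: p is stuck in H and scores h, while in G the stop
    -- has already dropped below h.
    ...     | no n = inj₁ (pass p N , guaranteed-pass o N ,
                λ b → n (subst (λ z → le p z _) (pstop-atom o H N eq) b))
    answer? : ∀ A → A ∈[ p ] H → Dist p p G H ⊎ Answer A
    answer? A m with ∈-dichotomy (side p G) (λ C n → decC C n A m)
    ... | inj₁ c = inj₂ (inj₁ c)
    ... | inj₂ dC with ∈-dichotomy (side q A) (decB A m)
    ...   | inj₁ b = inj₂ (inj₂ b)
    ...   | inj₂ dB = inj₁ (Separate.dist o G A (λ C n → dist⇒sep p p (dC C n))
              (λ B n → dist⇒sep p q (dist-convert o (dB B n))) m)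
    combine : Dist p p G H ⊎ (∀ h → side p H ≡ atom h → ∀ k → le p h (pstop p p G k)) →
      (∃[ A ] (A ∈[ p ] H × Dist p p G H)) ⊎ (∀ A → A ∈[ p ] H → Answer A) →
      Half p q G H ⊎ Dist p p G H
    combine (inj₁ d) _ = inj₂ d
    combine (inj₂ _) (inj₁ (_ , _ , d)) = inj₂ d
    combine (inj₂ a) (inj₂ b) = inj₁ (record { atomic = a ; answer = b })

  ge-dec-flip : ∀ {p q} → Opp p q → ∀ {G H} → Ge p G H ⊎ Dist p p G H → Ge q H G ⊎ Dist q q H G
  ge-dec-flip o (inj₁ h) = inj₁ (ge-flip o h)
  ge-dec-flip o (inj₂ d) = inj₂ (dist-own (opp-sym o) d)

  abstract
    -- The q half compares options in reversed roles, so the same hypotheses serve it after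
    -- `ge-dec-flip`. Induction on followers is used because a reply B lies two moves below G or H.
    ge-dec : ∀ {p q} → Opp p q → ∀ G H → Guaranteed G → Guaranteed H → Ge p G H ⊎ Dist p p G H
    ge-dec {p} {q} o = follower-ind (λ G → ∀ H → P G H) λ G ihG →
      follower-ind (P G) λ H ihH gG gH →
      combine G H gG gH
        (half-dec o G H gG
          (λ C m A n → ihG p C m C here A (guaranteed-option p gG m) (guaranteed-option p gH n))
          (λ A m B n → ihH p A m B (via q n here) gG
            (guaranteed-option q (guaranteed-option p gH m) n)))
        (half-dec (opp-sym o) H G gH
          (λ C m A n → ge-dec-flip o
            (ihG q A n A here C (guaranteed-option q gG n) (guaranteed-option q gH m)))
          (λ A m B n → ge-dec-flip o
            (ihG q A m B (via p n here) H (guaranteed-option p (guaranteed-option q gG m) n) gH)))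
      where
      P : Game → Game → Set
      P G H = Guaranteed G → Guaranteed H → Ge p G H ⊎ Dist p p G H
      combine : ∀ G H → Guaranteed G → Guaranteed H → Half p q G H ⊎ Dist p p G H →
        Half q p H G ⊎ Dist q q H G → Ge p G H ⊎ Dist p p G H
      combine G H gG gH (inj₁ a) (inj₁ b) = inj₁ (ge-sound o G H gG gH a b)
      combine G H gG gH (inj₁ _) (inj₂ d) = inj₂ (dist-own o d)
      combine G H gG gH (inj₂ d) _ = inj₂ d

  ge? : ∀ {p q} → Opp p q → ∀ G H → Guaranteed G → Guaranteed H → Dec (Ge p G H)
  ge? {p} o G H gG gH with ge-dec o G H gG gH
  ... | inj₁ h = yes h
  ... | inj₂ d = no (dist⇒¬ge p p d)

  -- Necessity is read off the decision: were the half to fail, `half-dec` would return a separating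
  -- game, against h.
  ge⇒half : ∀ {p q} → Opp p q → ∀ G H → Guaranteed G → Guaranteed H → Ge p G H → Half p q G H
  ge⇒half {p} {q} o G H gG gH h with half-dec o G H gG
    (λ C m A n → ge-dec o C A (guaranteed-option p gG m) (guaranteed-option p gH n))
    (λ A m B n → ge-dec o G B gG (guaranteed-option q (guaranteed-option p gH m) n))
  ... | inj₁ hf = hf
  ... | inj₂ d = ⊥-elim (dist⇒¬ge p p d h)

  -- Identity of games

  side-ident : ∀ {G H} → Ident G H → ∀ p → IdentS (side p G) (side p H)
  side-ident ⟨ l ∣ r ⟩ L = l
  side-ident ⟨ l ∣ r ⟩ R = r

  mkIdent : ∀ {G H} → (∀ p → IdentS (side p G) (side p H)) → Ident G H
  mkIdent {⟨ _ ∣ _ ⟩} {⟨ _ ∣ _ ⟩} h = ⟨ h L ∣ h R ⟩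

  ident-refl : ∀ G → Ident G G
  ident-refl = game-ind (λ G → Ident G G) λ G ih → mkIdent λ p → go (side p G) (ih p)
    where
    go : ∀ S → (∀ A → A ∈S S → Ident A A) → IdentS S S
    go (atom s) ih = atom
    go (opts xs) ih = opts (λ x m → x , m , ih x m) (λ x m → x , m , ih x m)

  ident-sym : ∀ {G H} → Ident G H → Ident H G
  ident-sym {G} {H} = game-ind (λ G → ∀ H → Ident G H → Ident H G)
    (λ G ih H i → mkIdent λ p → go (ih p) (side-ident i p)) G H
    where
    go : ∀ {S T} → (∀ A → A ∈S S → ∀ B → Ident A B → Ident B A) → IdentS S T → IdentS T S
    go ih atom = atom
    go ih (opts f g) = opts
      (λ y m → let (x , n , i) = g y m in x , n , ih x n y i)
      (λ x m → let (y , n , i) = f x m in y , n , ih x m y i)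

  ident-trans : ∀ {G H K} → Ident G H → Ident H K → Ident G K
  ident-trans {G} {H} {K} = game-ind (λ G → ∀ H K → Ident G H → Ident H K → Ident G K)
    (λ G ih H K i j → mkIdent λ p → go (ih p) (side-ident i p) (side-ident j p)) G H K
    where
    go : ∀ {S T U} → (∀ A → A ∈S S → ∀ B C → Ident A B → Ident B C → Ident A C) →
      IdentS S T → IdentS T U → IdentS S U
    go ih atom atom = atom
    go ih (opts f g) (opts f′ g′) = opts
      (λ x m → let (y , n , i) = f x m ; (z , k , j) = f′ y n in z , k , ih x m y z i j)
      (λ z m → let (y , n , j) = g′ z m ; (x , k , i) = g y n in x , k , ih x k y z i j)

  abstract
    ident? : ∀ G H → Dec (Ident G H)
    ident? = game-ind (λ G → ∀ H → Dec (Ident G H)) λ G ih H →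
      both (go (side L G) (side L H) (ih L)) (go (side R G) (side R H) (ih R))
      where
      both : ∀ {G H} → Dec (IdentS (side L G) (side L H)) → Dec (IdentS (side R G) (side R H)) →
        Dec (Ident G H)
      both (yes a) (yes b) = yes (mkIdent λ { L → a ; R → b })
      both (no n) _ = no λ i → n (side-ident i L)
      both (yes _) (no n) = no λ i → n (side-ident i R)
      choose : ∀ S {P : Game → Set} → (∀ A → A ∈S S → Dec (P A)) →
        (∃[ A ] (A ∈S S × P A)) ⊎ (∀ A → A ∈S S → ¬ P A)
      choose S d = ∈-dichotomy S λ A m → toSum (d A m)
      go : ∀ S T → (∀ A → A ∈S S → ∀ B → Dec (Ident A B)) → Dec (IdentS S T)
      go (atom s) (atom t) ih with s ≤? t | t ≤? s
      ... | yes a | yes b = yes (subst (λ z → IdentS (atom s) (atom z)) (≤-antisym a b) atom)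
      ... | no n | _ = no λ { atom → n ≤-refl }
      ... | yes _ | no n = no λ { atom → n ≤-refl }
      go (atom _) (opts _) ih = no λ ()
      go (opts _) (atom _) ih = no λ ()
      go (opts xs) (opts ys) ih
        with ∈-dichotomy (opts xs) (λ x m → swap (choose (opts ys) (λ y _ → ih x m y)))
           | ∈-dichotomy (opts ys) (λ y _ → swap (choose (opts xs) (λ x m → ih x m y)))
      ... | inj₁ (x , m , n) | _ = no λ { (opts f g) → let (y , k , i) = f x m in n y k i }
      ... | inj₂ _ | inj₁ (y , m , n) = no λ { (opts f g) → let (x , k , i) = g y m in n x k i }
      ... | inj₂ f | inj₂ g = yes (opts f g)

  ident-option : ∀ {G H} → Ident G H → ∀ p {A} → A ∈[ p ] G → ∃[ B ] (B ∈[ p ] H × Ident A B)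
  ident-option i p = go (side-ident i p)
    where
    go : ∀ {S T A} → IdentS S T → A ∈S S → ∃[ B ] (B ∈S T × Ident A B)
    go (opts f g) m = f _ m

  ident-atom : ∀ {G H} → Ident G H → ∀ p {s} → side p G ≡ atom s → side p H ≡ atom s
  ident-atom i p = go (side-ident i p)
    where
    go : ∀ {S T s} → IdentS S T → S ≡ atom s → T ≡ atom s
    go atom e = e

  -- `Ident` treats option lists as sets, so it is not `_≡_` and allows no rewriting; play is copied
  -- move by move instead.
  ident-stop : ∀ {p q} → Opp p q → ∀ {G H} → Ident G H → ∀ X r →
    le p (stop r (G ⊕ X)) (stop r (H ⊕ X))
  ident-stop {p} {q} o {G} {H} i X r = game-ind₂ P
    (λ G X ihG ihX H i r →
      [ (λ { refl → own ihG ihX i (stop-⊕ o G X) })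
      , (λ { refl → other ihG ihX i (stop-⊕ (opp-sym o) H X) }) ]′ (opp-cases o r)) G X H i r
    where
    P : Game → Game → Set
    P G X = ∀ H → Ident G H → ∀ r → le p (stop r (G ⊕ X)) (stop r (H ⊕ X))
    own : ∀ {G X H} → (∀ r A → A ∈[ r ] G → P A X) → (∀ r B → B ∈[ r ] X → P G B) → Ident G H →
      StopSum p q G X → le p (stop p (G ⊕ X)) (stop p (H ⊕ X))
    own {G} {X} {H} ihG ihX i (atoms ea eb e) =
      le-reflexive p (trans e (sym (stop-⊕-atoms o H X (ident-atom i p ea) eb)))
    own {G} {X} {H} ihG ihX i (left m e) = let (B , n , j) = ident-option i p m in
      le-trans p (le-reflexive p e) (le-trans p (ihG p _ m B j q) (stop-⊕ˡ o H X n))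
    own {G} {X} {H} ihG ihX i (right m e) =
      le-trans p (le-reflexive p e) (le-trans p (ihX p _ m H i q) (stop-⊕ʳ o H X m))
    other : ∀ {G X H} → (∀ r A → A ∈[ r ] G → P A X) → (∀ r B → B ∈[ r ] X → P G B) → Ident G H →
      StopSum q p H X → le p (stop q (G ⊕ X)) (stop q (H ⊕ X))
    other {G} {X} {H} ihG ihX i (atoms ea eb e) = le-reflexive p
      (trans (stop-⊕-atoms (opp-sym o) G X (ident-atom (ident-sym i) q ea) eb) (sym e))
    other {G} {X} {H} ihG ihX i (left m e) = let (A , n , j) = ident-option (ident-sym i) q m in
      le-trans p (stop-⊕ˡ′ o G X n)
        (le-trans p (ihG q A n _ (ident-sym j) p) (le-reflexive p (sym e)))
    other {G} {X} {H} ihG ihX i (right m e) = le-trans p (stop-⊕ʳ′ o G X m)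
      (le-trans p (ihX q _ m H i p) (le-reflexive p (sym e)))

  ident⇒ge : ∀ {p q} → Opp p q → ∀ {G H} → Ident G H → Ge p G H
  ident⇒ge {p} o i = mkGe p λ X _ r → ident-stop o (ident-sym i) X r

  ident-occurs : ∀ {s G H} → Ident G H → Occurs s G → Occurs s H
  ident-occurs {s} {G} {H} i occ = game-ind (λ G → ∀ H → Ident G H → Occurs s G → Occurs s H)
    (λ G ih H i occ →
      [ (λ { (p , e) → occurs-side p (ident-atom i p e) })
      , (λ { (p , A , m , occ′) → let (B , n , j) = ident-option i p m in
             occurs-option p n (ih p A m B j occ′) }) ]′ (occurs-view occ)) G H i occ

  -- Infinite descent: an identity of A with C carries the path from A through B to C over to a path
  -- starting at C, which ends in a game identical to C.
  ident-no-descent : ∀ p q A {B C} → B ∈[ q ] A → C ∈[ p ] B → ¬ Ident A C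
  ident-no-descent p q A m n = follower-ind (λ A → ∀ B C → B ∈[ q ] A → C ∈[ p ] B → ¬ Ident A C)
    (λ A ih B C m n i →
      let (B′ , m′ , j) = ident-option i q m
          (C′ , n′ , k) = ident-option j p n
      in ih q B m C (via p n here) B′ C′ m′ n′ k) A _ _ m n

  -- Pass-allowed stops as values

  -- Unfolds to `ULs` and `URs` for p = L, and to `OLs` and `ORs` for p = R.
  U : Player → Player → Game → ℝ → Set
  U p r G v = (∃[ k ] pstop p r G k ≡ v) × (∀ k → le p v (pstop p r G k))

  abstract
    U-exists : ∀ {p q} → Opp p q → ∀ G → Guaranteed G → ∀ r → ∃[ v ] U p r G v
    U-exists o G g r = let (N , _ , h) = stable o G g r in _ , (N , refl) , h

  U-ge : ∀ {p q} → Opp p q → ∀ r {G H v w} → Ge p G H → U p r G v → U p r H w → le p w v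
  U-ge {p} o r h ((k , refl) , _) (_ , b) =
    le-trans p (b k) (ge-stop p h (pass p k) (guaranteed-pass o k) r)

  U-∼ : ∀ {p q} → Opp p q → ∀ r {G H v w} → Ge p G H → Ge p H G → U p r G v → U p r H w → v ≡ w
  U-∼ {p} o r h h′ u u′ = le-antisym p (U-ge o r h′ u′ u) (U-ge o r h u u′)

  U-unique : ∀ p r {G v w} → U p r G v → U p r G w → v ≡ w
  U-unique p r ((k , refl) , a) ((j , refl) , b) = le-antisym p (a j) (b k)

  U-option : ∀ {p q} → Opp p q → ∀ G {A v w} → A ∈[ p ] G → U p p G v → U p q A w → le p w v
  U-option {p} o G m ((k , refl) , _) (_ , b) = le-trans p (b k) (stop-⊕ˡ o G (pass p k) m)

  abstract
    U-attained : ∀ {p q} → Opp p q → ∀ G → Guaranteed G → ∀ {A v} → A ∈[ p ] G → U p p G v →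
      ∃[ C ] (C ∈[ p ] G × U p q C v)
    U-attained {p} {q} o G g {v = v} m u with pstop-pick o G g v (proj₂ u)
    ... | inj₁ (a , e , _) = ∈-atom e m
    ... | inj₂ (C , n , h) with U-exists o C (guaranteed-option p g n) q
    ...   | w , w∈@((k , refl) , _) = C , n ,
      subst (U p q C) (le-antisym p (U-option o G n u w∈) (h k)) w∈

  U-atom : ∀ {p q} → Opp p q → ∀ G {a v} → side p G ≡ atom a → U p p G v → v ≡ a
  U-atom o G e ((k , refl) , _) = pstop-atom o G k e

  abstract
    U-transport : ∀ {p q} → Opp p q → ∀ r {G H v} → Guaranteed H → Ge p G H → Ge p H G →
      U p r G v → U p r H v
    U-transport {p} o r {H = H} gH h h′ u with U-exists o H gH r
    ... | w , u′ = subst (U p r H) (sym (U-∼ o r h h′ u u′)) u′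

  -- Waiting games with a real

  wait : Player → ℝ → ℕ → Game
  wait p s n = real s ⊕ pass p n

  guaranteed-wait : ∀ {p q} → Opp p q → ∀ s n → Guaranteed (wait p s n)
  guaranteed-wait {p} o s n = guaranteed-⊕ (real s) (pass p n) (guaranteed-real s) (guaranteed-pass o n)

  occurs-wait : ∀ {p q} → Opp p q → ∀ s n {t} → Occurs t (wait p s n) → t ≡ s
  occurs-wait {p} o s n occ =
    let (a , b , oa , ob , e) = occurs-⊕ (real s) (pass p n) occ
    in trans e (trans (cong₂ _+_ (occurs-real oa) (occurs-pass o n ob)) (+-identityʳ s))

  side-wait : ∀ {p q} → Opp p q → ∀ s n → side p (wait p s n) ≡ atom s
  side-wait {p} o s n = trans
    (side-⊕-atom p (real s) (pass p n) (side-real p s) (side-pass o n)) (cong atom (+-identityʳ s))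

  wait-∈ : ∀ {p q} → Opp p q → ∀ s n → wait p s n ∈[ q ] wait p s (suc n)
  wait-∈ {p} {q} o s n = ∈-⊕ʳ q (real s) (pass p (suc n)) (pass-∈ o n)

  pstop-wait : ∀ {p q x y} → Opp p q → Opp x y → ∀ s n r k → pstop x r (wait p s n) k ≡ s
  pstop-wait {p} {q} {x} o o′ s n r k = trans
    (≤-antisym (bound R) (bound L)) (+-identityʳ s)
    where
    bound : ∀ z → le z (s + 0#) (pstop x r (wait p s n) k)
    bound z = LB-stop z (wait p s n) (pass x k)
      (λ t occ → le-reflexive z (sym (occurs-wait o s n occ)))
      (λ t occ → le-reflexive z (sym (occurs-pass o′ k occ))) r

  -- Enough waiting moves let q mirror each q-move in K by a pass, while p is stuck at s, the least
  -- that K can give. Asking for all n from N on lets the bounds of the options be merged.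
  ge-wait : ∀ {p q} → Opp p q → ∀ s K → Guaranteed K → LB p s K →
    ∃[ N ] (∀ n → N ℕ.≤ n → Ge p K (wait p s n))
  ge-wait {p} {q} o s = game-ind P λ K ih g lb →
    let (M , h) = ∈-bound (side q K) (λ A N → ∀ n → N ℕ.≤ n → Ge p A (wait p s n)) 0
          (λ a b → a ℕ.⊔ b ,
            (λ x f n le → f n (ℕₚ.≤-trans (ℕₚ.m≤m⊔n a b) le)) ,
            (λ x f n le → f n (ℕₚ.≤-trans (ℕₚ.m≤n⊔m a b) le)))
          (λ A m → ih q A m (guaranteed-option q g m) (LB-option p q lb m))
    -- The mirrored move consumes one waiting move.
    in suc M , λ { (suc n) (ℕ.s≤s M≤n) →
         ge-sound o K (wait p s (suc n)) g (guaranteed-wait o s (suc n))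
           (record
             { atomic = λ t e k → subst₂ (le p)
                 (trans (+-identityʳ s) (atom-injective (trans (sym (side-wait o s (suc n))) e))) refl
                 (LB-stop p K (pass p k) lb (λ u occ → le-reflexive p (sym (occurs-pass o k occ))) p)
             ; answer = λ A m → ∈-atom (side-wait o s (suc n)) m })
           (record
             { atomic = λ t e k → subst (le q t) (sym (pstop-wait o (opp-sym o) s (suc n) q k))
                 (le-flip o (lb t (occurs-side q e)))
             ; answer = λ A m → inj₁ (wait p s n , wait-∈ o s n , ge-flip o (h A m n M≤n)) }) }
    where
    P : Game → Set
    P K = Guaranteed K → LB p s K → ∃[ N ] (∀ n → N ℕ.≤ n → Ge p K (wait p s n))

  least : ∀ {P : ℕ → Set} → (∀ n → Dec (P n)) → ∀ N → P N → ∃[ n ] (P n × (∀ m → m ℕ.< n → ¬ P m))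
  least {P} d zero h = zero , h , λ _ ()
  least {P} d (suc N) h with d zero
  ... | yes z = zero , z , λ _ ()
  ... | no nz with least (λ n → d (suc n)) N h
  ...   | n , hn , l = suc n , hn , λ { zero _ → nz ; (suc m) (ℕ.s≤s lt) → l m lt }

  -- Consequences of being reduced

  TopReduced : Game → Set
  TopReduced G = ∀ K → Reduction G K → Ident G K

  -- Unfolds to `LeftIIIb` or `RightIIIb` once the players are known, so a proof can be passed
  -- directly to `red-iii-b` and `red-iv`.
  IIIb : Player → Player → Game → Game → ℝ → ℕ → Set
  IIIb p q G A ℓ n =
    A ∈[ p ] G ×
    (∃[ B ] (B ∈[ q ] A × Ge p G B × side p B ≡ atom ℓ)) ×
    (∃[ v ] (U p p G v × U p q A v ×
      (∀ C → C ∈[ p ] G → ¬ Ident C A → ∀ w → U p q C w → le p w v × ¬ le p v w))) ×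
    Ge p G (wait p ℓ n) ×
    (∀ m → m ℕ.< n → ¬ Ge p G (wait p ℓ m))

  others : List⁺ Game → Game → List Game
  others xs A = filter (λ x → ¬? (ident? x A)) (toList xs)

  to⁺ : ∀ l {x : Game} → x ∈ l → ∃[ ys ] toList ys ≡ l
  to⁺ (y ∷ ys) m = y ∷ ys , refl

  ∈-others⁻ : ∀ xs A {y} → y ∈ others xs A → Others xs A y
  ∈-others⁻ xs A {y} m =
    let (n , h) = ∈-filter⁻ (λ x → ¬? (ident? x A)) {xs = toList xs} m in y , n , h , ident-refl y

  -- The survivor C makes the remaining list nonempty, as `List⁺` demands.
  setIs-others : ∀ xs A {C} → C ∈ toList xs → ¬ Ident C A → ∃[ ys ] SetIs ys (Others xs A)
  setIs-others xs A m n with to⁺ (others xs A) (∈-filter⁺ (λ x → ¬? (ident? x A)) m n)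
  ... | ys , e = ys ,
    (λ y k → ∈-others⁻ xs A (subst (y ∈_) e k)) ,
    (λ { z (x , k , h , i) → x , subst (x ∈_) (sym e) (∈-filter⁺ (λ x → ¬? (ident? x A)) k h) , i })

  setIs-replace : ∀ xs A (bs : List⁺ Game) →
    ∃[ ys ] SetIs ys (λ z → Others xs A z ⊎ ∃[ b ] (b ∈ toList bs × Ident b z))
  setIs-replace xs A (b ∷ bs) with to⁺ (others xs A ++ b ∷ bs) (∈-++⁺ʳ (others xs A) (here refl))
  ... | ys , e = ys ,
    (λ y k → [ (λ h → inj₁ (∈-others⁻ xs A h)) , (λ h → inj₂ (y , h , ident-refl y)) ]′
      (∈-++⁻ (others xs A) (subst (y ∈_) e k))) ,
    (λ { z (inj₁ (x , k , h , i)) → x ,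
           subst (x ∈_) (sym e) (∈-++⁺ˡ (∈-filter⁺ (λ x → ¬? (ident? x A)) k h)) , i
       ; z (inj₂ (x , k , i)) → x , subst (x ∈_) (sym e) (∈-++⁺ʳ (others xs A) k) , i })

  setIs-member : ∀ {xs ys P A} → IdentS (opts xs) (opts ys) → SetIs ys P → A ∈ toList xs →
    ∃[ y ] (P y × Ident A y)
  setIs-member (opts f g) (h , _) m = let (y , n , i) = f _ m in y , h y n , i

  others-absurd : ∀ {xs A y} {X : Set} → Others xs A y → Ident A y → X
  others-absurd (x , m , n , i) j = ⊥-elim (n (ident-trans i (ident-sym j)))

  delete-absurd : ∀ {xs ys A} {X : Set} → IdentS (opts xs) (opts ys) → SetIs ys (Others xs A) →
    A ∈ toList xs → X
  delete-absurd i s m = let (y , h , j) = setIs-member i s m in others-absurd h j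

  replace-ident : ∀ {xs ys A} {Q : Game → Set} → IdentS (opts xs) (opts ys) →
    SetIs ys (λ z → Others xs A z ⊎ Q z) → A ∈ toList xs → ∃[ y ] (Q y × Ident A y)
  replace-ident i s m with setIs-member i s m
  ... | y , inj₁ h , j = others-absurd h j
  ... | y , inj₂ h , j = y , h , j

  reduced-dominated : ∀ {p q} → Opp p q → ∀ G → TopReduced G → ∀ {A B} →
    A ∈[ p ] G → B ∈[ p ] G → Ge p B A → Ident A B
  reduced-dominated LR ⟨ opts xs ∣ _ ⟩ red {A} {B} a b h with ident? A B
  ... | yes i = i
  ... | no n = let (ys , s) = setIs-others xs A b (λ i → n (ident-sym i)) in
    delete-absurd (side-ident (red _ (inj₁ (red-i a b n h s))) L) s a
  reduced-dominated RL ⟨ _ ∣ opts xs ⟩ red {A} {B} a b h with ident? A B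
  ... | yes i = i
  ... | no n = let (ys , s) = setIs-others xs A b (λ i → n (ident-sym i)) in
    delete-absurd (side-ident (red _ (inj₂ (red-i a b n h s))) R) s a

  -- If B had p-options, (ii) would have to leave G identical, making A identical to one of them,
  -- two moves below A itself.
  reduced-reversible : ∀ {p q} → Opp p q → ∀ G → TopReduced G → ∀ {A B} →
    A ∈[ p ] G → B ∈[ q ] A → Ge p G B → ∃[ ℓ ] side p B ≡ atom ℓ
  reduced-reversible LR ⟨ opts xs ∣ _ ⟩ red {A} {B@(⟨ atom ℓ ∣ _ ⟩)} a b h = ℓ , refl
  reduced-reversible LR ⟨ opts xs ∣ _ ⟩ red {A} {B@(⟨ opts bs ∣ _ ⟩)} a b h =
    let (ys , s) = setIs-replace xs A bs
        (y , (c , m , i) , j) =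
          replace-ident (side-ident (red _ (inj₁ (red-ii a b h refl s))) L) s a
    in ⊥-elim (ident-no-descent L R A b m (ident-trans j (ident-sym i)))
  reduced-reversible RL ⟨ _ ∣ opts xs ⟩ red {A} {B@(⟨ _ ∣ atom ℓ ⟩)} a b h = ℓ , refl
  reduced-reversible RL ⟨ _ ∣ opts xs ⟩ red {A} {B@(⟨ _ ∣ opts bs ⟩)} a b h =
    let (ys , s) = setIs-replace xs A bs
        (y , (c , m , i) , j) =
          replace-ident (side-ident (red _ (inj₂ (red-ii a b h refl s))) R) s a
    in ⊥-elim (ident-no-descent R L A b m (ident-trans j (ident-sym i)))

  reduced-IIIa : ∀ {p q} → Opp p q → ∀ G → TopReduced G → ∀ {A B C ℓ v} →
    A ∈[ p ] G → B ∈[ q ] A → Ge p G B → side p B ≡ atom ℓ →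
    C ∈[ p ] G → ¬ Ident C A → U p p G v → ¬ U p q C v
  reduced-IIIa LR ⟨ opts xs ∣ _ ⟩ red {A} a b h e c n u u′ =
    let (ys , s) = setIs-others xs A c n in
    delete-absurd (side-ident
      (red _ (inj₁ (red-iii-a a b h e (_ , c , n , _ , u , u′) s))) L) s a
  reduced-IIIa RL ⟨ _ ∣ opts xs ⟩ red {A} a b h e c n u u′ =
    let (ys , s) = setIs-others xs A c n in
    delete-absurd (side-ident
      (red _ (inj₂ (red-iii-a a b h e (_ , c , n , _ , u , u′) s))) R) s a

  setIs-wait : ∀ xs A W → ∃[ ys ] SetIs ys (λ z → Others xs A z ⊎ Ident W z)
  setIs-wait xs A W with setIs-replace xs A List⁺.[ W ]
  ... | ys , f , g = ys ,
    (λ y m → [ inj₁ , (λ { (_ , here refl , i) → inj₂ i }) ]′ (f y m)) ,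
    (λ z → [ (λ h → g z (inj₁ h)) , (λ i → g z (inj₂ (W , here refl , i))) ]′)

  reduced-IIIb : ∀ {p q} → Opp p q → ∀ G → TopReduced G → ∀ {A ℓ n} →
    IIIb p q G A ℓ n → Ident A (wait p ℓ (suc n))
  reduced-IIIb LR ⟨ opts xs ∣ _ ⟩ red {A} {ℓ} {n} h =
    let (ys , s) = setIs-wait xs A (wait L ℓ (suc n))
        (y , i , j) = replace-ident (side-ident (red _ (inj₁ (red-iii-b h s))) L) s (proj₁ h)
    in ident-trans j (ident-sym i)
  reduced-IIIb RL ⟨ _ ∣ opts xs ⟩ red {A} {ℓ} {n} h =
    let (ys , s) = setIs-wait xs A (wait R ℓ (suc n))
        (y , i , j) = replace-ident (side-ident (red _ (inj₂ (red-iii-b h s))) R) s (proj₁ h)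
    in ident-trans j (ident-sym i)

  reduced-IV : ∀ {p q} → Opp p q → ∀ G → TopReduced G → ∀ {A ℓ n} → IIIb p q G A ℓ n →
    (∀ x → x ∈[ p ] G → Ident x A) → ¬ Guaranteed (node p (atom ℓ) (side q G))
  reduced-IV LR ⟨ opts xs ∣ _ ⟩ red h only g with side-ident (red _ (inj₁ (red-iv h only g))) L
  ... | ()
  reduced-IV RL ⟨ _ ∣ opts xs ⟩ red h only g with side-ident (red _ (inj₂ (red-iv h only g))) R
  ... | ()

  abstract
    -- As (iii)'s deletion is void in a reduced game, no option other than A attains the
    -- pass-allowed stop; some option does attain it, so it is A up to identity.
    reversible⇒IIIb : ∀ {p q} → Opp p q → ∀ G → Guaranteed G → TopReduced G → ∀ {A B} →
      A ∈[ p ] G → B ∈[ q ] A → Ge p G B → ∃[ ℓ ] ∃[ n ] IIIb p q G A ℓ n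
    reversible⇒IIIb {p} {q} o G g red {A} {B} a b h =
      let gA = guaranteed-option p g a
          gB = guaranteed-option q gA b
          (ℓ , e) = reduced-reversible o G red a b h
          -- Bounds the search for n: G is at least B, and B is at least ℓ with N waiting moves
          -- because its atom ℓ is extreme.
          (N , hN) = ge-wait o ℓ B gB (guaranteed-atom p gB e)
          (n , hn , l) = least (λ n → ge? o G (wait p ℓ n) g (guaranteed-wait o ℓ n)) N
            (ge-trans p h (hN N ℕₚ.≤-refl))
          (v , u) = U-exists o G g p
          below-v : ∀ C → C ∈[ p ] G → ¬ Ident C A → ∀ w → U p q C w → le p w v × ¬ le p v w
          below-v = λ C c ne w u′ → U-option o G c u u′ , λ v≤w →
            reduced-IIIa o G red a b h e c ne u
              (subst (U p q C) (le-antisym p (U-option o G c u u′) v≤w) u′)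
          (D , d , uD) = U-attained o G g a u
      in ℓ , n , a , (B , b , h , e) , (v , u , attained gA below-v D d uD , below-v) , hn , l
      where
      attained : ∀ {v} → Guaranteed A →
        (∀ C → C ∈[ p ] G → ¬ Ident C A → ∀ w → U p q C w → le p w v × ¬ le p v w) →
        ∀ D → D ∈[ p ] G → U p q D v → U p q A v
      attained {v} gA below-v D d uD with ident? D A
      ... | yes i = U-transport o q gA (ident⇒ge o i) (ident⇒ge o (ident-sym i)) uD
      ... | no n = ⊥-elim (proj₂ (below-v D d n v uD) (le-refl p))

  -- A is identical to a game all of whose atoms are ℓ, and passes add only 0.
  IIIb-value : ∀ {p q} → Opp p q → ∀ G → TopReduced G → ∀ {A ℓ n v} →
    IIIb p q G A ℓ n → U p q A v → v ≡ ℓ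
  IIIb-value {p} {q} o G red {A} {ℓ} {n} h u =
    let i = reduced-IIIb o G red h
        ((k , e) , _) = U-transport o q (guaranteed-wait o ℓ (suc n))
          (ident⇒ge o i) (ident⇒ge o (ident-sym i)) u
    in trans (sym e) (pstop-wait o o ℓ (suc n) q k)

  -- Matching the options of equivalent reduced games

  NonReversible : Player → Player → Game → Game → Set
  NonReversible p q G A = ∀ B → B ∈[ q ] A → ¬ Ge p G B

  reversible-dec : ∀ {p q} → Opp p q → ∀ G A → Guaranteed G → Guaranteed A →
    (∃[ B ] (B ∈[ q ] A × Ge p G B)) ⊎ NonReversible p q G A
  reversible-dec {p} {q} o G A gG gA = ∈-dichotomy (side q A) λ B m →
    toSum (ge? o G B gG (guaranteed-option q gA m))

  -- The field `options` is the induction hypothesis of `unique`, restricted to the options of one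
  -- player.
  record Twins (p : Player) (G H : Game) : Set where
    field
      guaranteedˡ : Guaranteed G
      guaranteedʳ : Guaranteed H
      reducedˡ : TopReduced G
      reducedʳ : TopReduced H
      G≥H : Ge p G H
      H≥G : Ge p H G
      options : ∀ {A B} → A ∈[ p ] G → B ∈[ p ] H → Ge p A B → Ge p B A → Ident A B

  twins-sym : ∀ {p G H} → Twins p G H → Twins p H G
  twins-sym t = record
    { guaranteedˡ = guaranteedʳ ; guaranteedʳ = guaranteedˡ
    ; reducedˡ = reducedʳ ; reducedʳ = reducedˡ ; G≥H = H≥G ; H≥G = G≥H
    ; options = λ a b h h′ → ident-sym (options b a h′ h) }
    where open Twins t

  -- The other kind of answer, some B below G, would lie below H as well and reverse A.
  nonreversible-answer : ∀ {p q} → Opp p q → ∀ {G H} → Twins p G H → ∀ {A} → A ∈[ p ] H →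
    NonReversible p q H A → ∃[ C ] (C ∈[ p ] G × Ge p C A)
  nonreversible-answer {p} o {G} {H} t a nr
    with Half.answer (ge⇒half o G H guaranteedˡ guaranteedʳ G≥H) _ a
    where open Twins t
  ... | inj₁ c = c
  ... | inj₂ (B , b , h) = ⊥-elim (nr B b (ge-trans p (Twins.H≥G t) h))

  -- Suppose C reverses through B. Since C is at least A, the move to B is answered either by a
  -- q-option D of A below B, which would reverse A, or by a p-option of B, which is excluded
  -- because B is p-atomic.
  answer-nonreversible : ∀ {p q} → Opp p q → ∀ {G H} → Twins p G H → ∀ {A C} → A ∈[ p ] H →
    NonReversible p q H A → C ∈[ p ] G → Ge p C A → NonReversible p q G C
  answer-nonreversible {p} {q} o {G} {H} t {A} {C} a nr c C≥A B b h
    with Half.answer (ge⇒half (opp-sym o) A C (guaranteed-option p guaranteedʳ a)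
           (guaranteed-option p guaranteedˡ c) (ge-flip o C≥A)) B b
    where open Twins t
  ... | inj₁ (D , d , h′) =
    nr D d (ge-trans p (Twins.H≥G t) (ge-trans p h (ge-flip (opp-sym o) h′)))
  ... | inj₂ (E , e , _) = ∈-atom (proj₂ (reduced-reversible o G (Twins.reducedˡ t) c b h)) e

  abstract
    match-nonreversible : ∀ {p q} → Opp p q → ∀ {G H} → Twins p G H → ∀ {A} → A ∈[ p ] H →
      NonReversible p q H A → ∃[ C ] (C ∈[ p ] G × NonReversible p q G C × Ident C A)
    match-nonreversible {p} o {G} {H} t a nr =
      let (C , c , C≥A) = nonreversible-answer o t a nr
          nrC = answer-nonreversible o t a nr c C≥A
          (D , d , D≥C) = nonreversible-answer o (twins-sym t) c nrC
          i = reduced-dominated o H reducedʳ a d (ge-trans p D≥C C≥A)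
      in C , c , nrC , options c a C≥A (ge-trans p (ident⇒ge o i) D≥C)
      where open Twins t

  least-unique : ∀ {p q} → Opp p q → ∀ {G H A C ℓ m n} → Ge p G H → Ge p H G →
    IIIb p q G C ℓ m → IIIb p q H A ℓ n → m ≡ n
  least-unique {p} o {m = m} {n} G≥H H≥G (_ , _ , _ , hm , lm) (_ , _ , _ , hn , ln) =
    ℕₚ.≤-antisym (ℕₚ.≮⇒≥ λ n<m → lm n n<m (ge-trans p G≥H hn))
                 (ℕₚ.≮⇒≥ λ m<n → ln m m<n (ge-trans p H≥G hm))

  IIIb-ident : ∀ {p q} → Opp p q → ∀ {G H A C ℓ ℓ′ m n} → Ge p G H → Ge p H G →
    TopReduced G → TopReduced H → IIIb p q G C ℓ m → IIIb p q H A ℓ′ n → ℓ ≡ ℓ′ → Ident C A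
  IIIb-ident {p} o {G} {H} {A} {ℓ = ℓ} G≥H H≥G rG rH y x refl = ident-trans (reduced-IIIb o G rG y)
    (subst (λ z → Ident (wait p ℓ (suc z)) A) (sym (least-unique o G≥H H≥G y x))
      (ident-sym (reduced-IIIb o H rH x)))

  -- C has an identical non-reversible twin in H. The twin cannot be A, which is reversible, so its
  -- pass-allowed stop is strictly short of v. Hence only a reversible option of G can attain v.
  nonreversible-small : ∀ {p q} → Opp p q → ∀ {G H} → Twins p G H → ∀ {A B C v} → B ∈[ q ] A → Ge p H B →
    (∀ D → D ∈[ p ] H → ¬ Ident D A → ∀ w → U p q D w → le p w v × ¬ le p v w) →
    C ∈[ p ] G → NonReversible p q G C → ¬ U p q C v
  nonreversible-small {p} {q} o {G} {H} t {A} {B} {C} {v} b h small c nr uC =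
    go (match-nonreversible o (twins-sym t) c nr)
    where
    go : ¬ (∃[ D ] (D ∈[ p ] H × NonReversible p q H D × Ident D C))
    go (D , d , nrD , i) = proj₂ (small D d
      (λ j → let (B′ , b′ , k) = ident-option (ident-sym j) q b in
        nrD B′ b′ (ge-trans p h (ident⇒ge o k))) v
      (U-transport o q (guaranteed-option p (Twins.guaranteedʳ t) d)
        (ident⇒ge o (ident-sym i)) (ident⇒ge o i) uC)) (le-refl p)

  -- `C₀` excludes an atomic side of G, so the common pass-allowed stop is attained by an option,
  -- necessarily a reversible one.
  match-reversible : ∀ {p q} → Opp p q → ∀ {G H} → Twins p G H → ∀ {A B C₀} → C₀ ∈[ p ] G →
    A ∈[ p ] H → B ∈[ q ] A → Ge p H B → ∃[ C ] (C ∈[ p ] G × Ident C A)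
  match-reversible {p} {q} o {G} {H} t {A} {B} c₀ a b h =
    go (reversible⇒IIIb o H guaranteedʳ reducedʳ a b h)
    where
    open Twins t
    go : (∃[ ℓ ] ∃[ n ] IIIb p q H A ℓ n) → ∃[ C ] (C ∈[ p ] G × Ident C A)
    go (ℓ , n , x@(_ , _ , (v , uH , uA , small) , _)) =
      found (U-attained o G guaranteedˡ c₀ (U-transport o p guaranteedˡ H≥G G≥H uH))
      where
      found : (∃[ C ] (C ∈[ p ] G × U p q C v)) → ∃[ C ] (C ∈[ p ] G × Ident C A)
      found (C , c , uC) = C , c ,
        [ (λ { (E , e , h′) → same (reversible⇒IIIb o G guaranteedˡ reducedˡ c e h′) })
        , (λ nr → ⊥-elim (nonreversible-small o t b h small c nr uC)) ]′
          (reversible-dec o G C guaranteedˡ (guaranteed-option p guaranteedˡ c))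
        where
        same : (∃[ ℓ′ ] ∃[ n′ ] IIIb p q G C ℓ′ n′) → Ident C A
        same (ℓ′ , n′ , y) = IIIb-ident o G≥H H≥G reducedˡ reducedʳ y x
          (trans (sym (IIIb-value o G reducedˡ y uC)) (IIIb-value o H reducedʳ x uA))

  match-option : ∀ {p q} → Opp p q → ∀ {G H} → Twins p G H → ∀ {C₀} → C₀ ∈[ p ] G → ∀ A →
    A ∈[ p ] H → ∃[ C ] (C ∈[ p ] G × Ident C A)
  match-option {p} o {G} {H} t c₀ A a
    with reversible-dec o H A (Twins.guaranteedʳ t) (guaranteed-option p (Twins.guaranteedʳ t) a)
  ... | inj₁ (B , b , h) = match-reversible o t c₀ a b h
  ... | inj₂ nr = let (C , c , _ , i) = match-nonreversible o t a nr in C , c , i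

  -- An atom facing a reversible option.

  Collapsed : Player → Player → Game → Game → Set
  Collapsed p q G H = ∃[ ℓ ] ∃[ A ] ∃[ n ]
    (side p G ≡ atom ℓ × IIIb p q H A ℓ n × (∀ x → x ∈[ p ] H → Ident x A))

  -- A non-reversible option of H would need an answer among the options of G, of which there are
  -- none. So every option of H attains the pass-allowed stop, which only copies of A can do, and
  -- that stop is the atom g.
  collapse : ∀ {p q} → Opp p q → ∀ {G H} → Twins p G H → ∀ {g A} → side p G ≡ atom g →
    A ∈[ p ] H → Collapsed p q G H
  collapse {p} {q} o {G} {H} t {g} {A} e a = go (reversible a) (U-exists o G guaranteedˡ p)
    where
    open Twins t
    reversible : ∀ {C} → C ∈[ p ] H → ∃[ ℓ ] ∃[ n ] IIIb p q H C ℓ n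
    reversible {C} c =
      [ (λ { (B , b , h) → reversible⇒IIIb o H guaranteedʳ reducedʳ c b h })
      , (λ nr → ∈-atom e (proj₁ (proj₂ (nonreversible-answer o t c nr)))) ]′
        (reversible-dec o H C guaranteedʳ (guaranteed-option p guaranteedʳ c))
    only : ∀ {v C} → U p p H v →
      (∀ C → C ∈[ p ] H → ¬ Ident C A → ∀ w → U p q C w → le p w v × ¬ le p v w) →
      C ∈[ p ] H → (∃[ ℓ ] ∃[ n ] IIIb p q H C ℓ n) → Dec (Ident C A) → Ident C A
    only uH small c _ (yes i) = i
    only uH small c (_ , _ , _ , _ , (w , uH′ , uC , _) , _) (no n) =
      ⊥-elim (proj₂ (small _ c n w uC) (le-reflexive p (U-unique p p uH uH′)))
    go : (∃[ ℓ ] ∃[ n ] IIIb p q H A ℓ n) → (∃[ w ] U p p G w) → Collapsed p q G H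
    go (ℓ , n , x@(_ , _ , (v , uH , uA , small) , _)) (w , uG) =
      ℓ , A , n , trans e (cong atom (sym ℓ≡g)) , x ,
      λ C c → only uH small c (reversible c) (ident? C A)
      where
      ℓ≡g : ℓ ≡ g
      ℓ≡g = trans (sym (IIIb-value o H reducedʳ x uA))
              (trans (U-∼ o p H≥G G≥H uH uG) (U-atom o G e uG))

  Outcome : Player → Player → Game → Game → Set
  Outcome p q G H = IdentS (side p G) (side p H) ⊎ Collapsed p q G H ⊎ Collapsed p q H G

  outcome-sym : ∀ {p q G H} → Outcome p q G H → Outcome p q H G
  outcome-sym (inj₁ i) = inj₁ (go i)
    where
    go : ∀ {S T} → IdentS S T → IdentS T S
    go atom = atom
    go (opts f g) = opts
      (λ y m → let (x , n , i) = g y m in x , n , ident-sym i)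
      (λ x m → let (y , n , i) = f x m in y , n , ident-sym i)
  outcome-sym (inj₂ (inj₁ c)) = inj₂ (inj₂ c)
  outcome-sym (inj₂ (inj₂ c)) = inj₂ (inj₁ c)

  outcome : ∀ {p q} → Opp p q → ∀ {G H} → Twins p G H → Outcome p q G H
  outcome {p} {q} o {G} {H} t = go (side p G) (side p H) refl refl
    where
    open Twins t
    go : ∀ S T → side p G ≡ S → side p H ≡ T → Outcome p q G H
    go (atom g) (atom h) eG eH = inj₁ (subst₂ IdentS (sym eG) (sym eH)
      (subst (λ z → IdentS (atom g) (atom z)) g≡h atom))
      where
      g≡h : g ≡ h
      g≡h = let (v , u) = U-exists o G guaranteedˡ p
                (w , u′) = U-exists o H guaranteedʳ p
            in trans (sym (U-atom o G eG u)) (trans (U-∼ o p G≥H H≥G u u′) (U-atom o H eH u′))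
    go (atom g) (opts (y ∷ ys)) eG eH =
      inj₂ (inj₁ (collapse o t eG (subst (y ∈S_) (sym eH) (here refl))))
    go (opts (x ∷ xs)) (atom h) eG eH =
      inj₂ (inj₂ (collapse o (twins-sym t) eH (subst (x ∈S_) (sym eG) (here refl))))
    go (opts (x ∷ xs)) (opts (y ∷ ys)) eG eH = inj₁ (subst₂ IdentS (sym eG) (sym eH) (opts
      (λ A a → let (C , c , i) = match-option o (twins-sym t) (subst (y ∈S_) (sym eH) (here refl)) A
                                   (subst (A ∈S_) (sym eG) a)
               in C , subst (C ∈S_) eH c , ident-sym i)
      (λ A a → let (C , c , i) = match-option o t (subst (x ∈S_) (sym eG) (here refl)) A
                                   (subst (A ∈S_) (sym eH) a)
               in C , subst (C ∈S_) eG c , i)))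

  SideOccurs : ℝ → Side → Set
  SideOccurs s S = S ≡ atom s ⊎ ∃[ A ] (A ∈S S × Occurs s A)

  sideOccurs⇒occurs : ∀ p {G s} → SideOccurs s (side p G) → Occurs s G
  sideOccurs⇒occurs p (inj₁ e) = occurs-side p e
  sideOccurs⇒occurs p (inj₂ (A , m , occ)) = occurs-option p m occ

  -- Weaker than identity of the sides, but true in the collapsed cases too, where ℓ is the only
  -- atom on either side. This breaks the circle of needing one side settled before the other.
  outcome-occurs : ∀ {p q} → Opp p q → ∀ {G H} → TopReduced G → TopReduced H → Outcome p q G H →
    ∀ {s} → SideOccurs s (side p H) → SideOccurs s (side p G)
  outcome-occurs {p} o rG rH (inj₁ i) = go i
    where
    go : ∀ {S T s} → IdentS S T → SideOccurs s T → SideOccurs s S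
    go atom h = h
    go (opts f g) (inj₂ (A , m , occ)) =
      let (B , n , j) = g A m in inj₂ (B , n , ident-occurs (ident-sym j) occ)
  outcome-occurs {p} o {G} {H} rG rH (inj₂ (inj₁ (ℓ , A , n , e , x , only))) {s} h = inj₁ (go h)
    where
    go : SideOccurs s (side p H) → side p G ≡ atom s
    go (inj₁ e′) = ∈-atom e′ (proj₁ x)
    go (inj₂ (B , b , occ)) = trans e (cong atom (sym (occurs-wait o ℓ (suc n)
      (ident-occurs (ident-trans (only B b) (reduced-IIIb o H rH x)) occ))))
  outcome-occurs {p} o {G} {H} rG rH (inj₂ (inj₂ (ℓ , A , n , e , x , only))) (inj₂ (_ , m , _)) =
    ∈-atom e m
  outcome-occurs {p} o {G} {H} rG rH (inj₂ (inj₂ (ℓ , A , n , e , x , only))) (inj₁ e′) =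
    inj₂ (A , proj₁ x , occurs-side p (ident-atom (ident-sym (reduced-IIIb o G rG x)) p
      (trans (side-wait o ℓ (suc n)) (trans (sym e) e′))))

  -- The condition of (iv) holds: G is guaranteed with atom ℓ, so ℓ bounds the atoms on the q-side
  -- of G, and those on the q-side of H are among them.
  collapsed-absurd : ∀ {p q} → Opp p q → ∀ {G H} → Guaranteed G → Guaranteed H → TopReduced H →
    (∀ {s} → SideOccurs s (side q H) → SideOccurs s (side q G)) → ¬ Collapsed p q G H
  collapsed-absurd {p} {q} o {G} {H} gG gH rH occurs (ℓ , A , n , e , x , only) =
    reduced-IV o H rH x only (guaranteed-node o (atom ℓ) S
      (λ { s refl t occ → [ (λ { refl → le-refl p }) , ℓ≤ ]′ (view occ) })
      (λ { s e′ t occ → [ (λ { refl → le-flip o (ℓ≤ (inj₁ e′)) })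
                        , [ (λ e″ → le-reflexive q (atom-injective (trans (sym e′) e″)))
                          , (λ { (B , b , _) → ∈-atom e′ b }) ]′ ]′ (view occ) })
      (λ _ ())
      (λ B b → guaranteed-option q gH b))
    where
    S : Side
    S = side q H
    ℓ≤ : ∀ {t} → SideOccurs t S → le p ℓ t
    ℓ≤ h = guaranteed-atom p gG e _ (sideOccurs⇒occurs q (occurs h))
    view : ∀ {t} → Occurs t (node p (atom ℓ) S) → t ≡ ℓ ⊎ SideOccurs t S
    view occ with occurs-view occ
    ... | inj₁ (r , e′) with opp-cases o r
    ...   | inj₁ refl = inj₁ (atom-injective (trans (sym e′) (side-node o (atom ℓ) S)))
    ...   | inj₂ refl = inj₂ (inj₁ (trans (sym (side-node′ o (atom ℓ) S)) e′))
    view occ | inj₂ (r , B , b , occ′) with opp-cases o r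
    ...   | inj₁ refl = ∈-atom (side-node o (atom ℓ) S) b
    ...   | inj₂ refl = inj₂ (inj₂ (B , ∈-node′⁻ o (atom ℓ) S b , occ′))

  outcome-ident : ∀ {p q} → Opp p q → ∀ {G H} → Guaranteed G → Guaranteed H →
    TopReduced G → TopReduced H → Outcome p q G H → Outcome q p G H → IdentS (side p G) (side p H)
  outcome-ident o gG gH rG rH (inj₁ i) _ = i
  outcome-ident o gG gH rG rH (inj₂ (inj₁ c)) w = ⊥-elim
    (collapsed-absurd o gG gH rH (outcome-occurs (opp-sym o) rG rH w) c)
  outcome-ident {p} {q} o {G} {H} gG gH rG rH (inj₂ (inj₂ c)) w = ⊥-elim
    (collapsed-absurd o gH gG rG (outcome-occurs (opp-sym o) rH rG (outcome-sym {q} {p} {G} {H} w)) c)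

  reduced-option : ∀ p {G A} → Reduced G → A ∈[ p ] G → Reduced A
  reduced-option p red m K f = red K (follower-trans f (via p m here))

  unique : ∀ G H → Guaranteed G → Guaranteed H → G ∼ H → Reduced G → Reduced H → Ident G H
  unique = game-ind P λ G ih H gG gH (G≽H , H≽G) rG rH →
    let twins : ∀ {p q} → Opp p q → Ge p G H → Ge p H G → Twins p G H
        twins = λ {p} o h h′ → record
          { guaranteedˡ = gG ; guaranteedʳ = gH
          ; reducedˡ = rG G here ; reducedʳ = rH H here ; G≥H = h ; H≥G = h′
          ; options = λ {A} {B} a b i j → ih p A a B (guaranteed-option p gG a)
              (guaranteed-option p gH b) (equivalent p i j) (reduced-option p rG a) (reduced-option p rH b) }
        -- Both outcomes are obtained before either is used: excluding a collapse on one side calls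
        -- for the atoms on the other.
        oL = outcome LR (twins LR G≽H H≽G)
        oR = outcome RL (twins RL H≽G G≽H)
    in mkIdent λ { L → outcome-ident LR gG gH (rG G here) (rH H here) oL oR
                 ; R → outcome-ident RL gG gH (rG G here) (rH H here) oR oL }
    where
    P : Game → Set
    P G = ∀ H → Guaranteed G → Guaranteed H → G ∼ H → Reduced G → Reduced H → Ident G H
    equivalent : ∀ p {A B} → Ge p A B → Ge p B A → A ∼ B
    equivalent L a b = a , b
    equivalent R a b = b , a

theorem42 : (RF : RealField) → let open Games RF in
    (G H : Game) → Guaranteed G → Guaranteed H →
    G ∼ H → Reduced G → Reduced H → Ident G H
theorem42 RF = Uniqueness.unique RF
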